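{- Let $R$ be either a not necessarily commutative ring $\mathcal{K}$ with associative powers, or a not necessarily commutative and not necessarily associative ring $\mathfrak{K}$, in each case with division by integers, and let $n\ge1$. For $n\times n$ matrices $A$ over $R$: (b) $edet(A)$ is an antisymmetric function of the rows and of the columns of $A$ (interchanging two distinct rows, or two distinct columns, changes $edet(A)$ to $-edet(A)$); (c) $edet(A)=0$ if $A$ contains a zero row or a zero column; (d) $edet(A)=0$ if $A$ contains two equal rows or two equal columns; (e) $edet(A)=edet(A^T)$. Moreover, the Laplace expansion formulas, the polyadditivity of $edet$ in the rows and columns of $A$ (additivity in each row, respectively column, when the others are fixed), and the formula $edet(AB)=edet(A)\,edet(B)$ are not valid in general, i.e. they do not hold for all such rings, all $n$, and all $n\times n$ matrices.
   Context: Rings have biadditive multiplication and are not assumed to have a unit. A ring is "with division by integers" if for every nonzero integer $m$ the map $x\mapsto mx$ is bijective on the ring; $\frac1m x$ denotes the inverse image of $x$. A ring has associative powers if every power $a^n$ of a single element is independent of the arrangement of brackets. $S_n^{(e)}$, $S_n^{(o)}$ are the sets of even and odd permutations of $\{1,\dots,n\}$. For $A=(a_{ij})$, a permutation $\sigma$ and $1\le i_1<\dots<i_k\le n$, the sequence $l=(a_{i_1\sigma(i_1)},\dots,a_{i_k\sigma(i_k)})$ is a subdiagonal of length $k$ of the diagonal $(a_{1\sigma(1)},\dots,a_{n\sigma(n)})$; subdiagonals are identified by their positions $\{(i_1,\sigma(i_1)),\dots,(i_k,\sigma(i_k))\}$ in the matrix (not merely by the values of the entries). $L_k^{(e)}$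 (respectively $L_k^{(o)}$) is the set of all subdiagonals of length $k$ of diagonals with $\sigma\in S_n^{(e)}$ (respectively $\sigma\in S_n^{(o)}$), and $su(l)=\sum_{s=1}^k a_{i_s\sigma(i_s)}$. For $n=1$, $L_0^{(e)}$ consists of the empty subdiagonal, with $su=0$, and $L_0^{(o)}=\emptyset$. Over $\mathcal{K}$, $$edet(A)=\frac{ -1}{n!}\Big\{\sum_{l\in L_{n-1}^{(e)}}su(l)^n-\sum_{l\in L_{n-1}^{(o)}}su(l)^n+\sum_{l\in L_n^{(o)}}su(l)^n-\sum_{l\in L_n^{(e)}}su(l)^n\Big\}.$$ Over $\mathfrak{K}$, $edet(A)$ is defined by the same formula with each $su(l)^n$ replaced by $Ass(su(l)^n)$, where for $a\in\mathfrak{K}$, $Ass(a^n)$ is $\frac1{C_n}$ times the sum, over all $C_n=\frac{(2n-2)!}{n!\,(n-1)!}$ arrangements of brackets in the $n$-fold product $a\times a\times\cdots\times a$, of the resulting products. The Laplace expansion formulas are $edet(A)=\sum_{j=1}^n(-1)^{i+j}a_{ij}\,edet(A_{ij})$ (row $i$) and $edet(A)=\sum_{i=1}^n(-1)^{i+j}a_{ij}\,edet(A_{ij})$ (column $j$), where $n\ge2$ and $A_{ij}$ is $A$ with row $i$ and column $j$ deleted.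
   Formalization: The claim that polyadditivity fails in general is false, since edet is additive in every row and column under the given definitions; polyadditivity is denied only jointly with the Laplace formulas and edet(AB)=edet(A)edet(B), while each of the latter is refuted separately. -}

module Defs where

open import Algebra.Bundles using (AbelianGroup)
open import Algebra.Core using (Op₁; Op₂)
open import Algebra.Structures using (IsAbelianGroup)
import Algebra.Definitions as AlgebraDefinitions
import Algebra.Definitions.RawMonoid as RawMonoidDefinitions
open import Data.Fin.Base as Fin using (Fin; toℕ; punchIn)
import Data.Fin.Properties as Fin
open import Data.Fin.Permutation using (Permutation′; _⟨$⟩ʳ_; id; insert)
open import Data.Fin.Permutation.Components using (transpose)
open import Data.Integer.Base as ℤ using (ℤ)
open import Data.List.Base as List
  using (List; []; _∷_; _++_; allFin; cartesianProduct; cartesianProductWith; deduplicate; filter; length)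
import Data.List.Properties as List
open import Data.Nat.Base as ℕ using (ℕ; zero; suc; _!)
import Data.Nat.DivMod as ℕ
import Data.Nat.Properties as ℕ
open import Data.Parity.Base using (Parity; 0ℙ; 1ℙ)
import Data.Parity.Properties as Parity
open import Data.Product.Base using (_×_; _,_; proj₁; proj₂; ∃)
import Data.Product.Properties as Product
open import Data.Tree.Binary using (Tree; leaf; node; foldr; #leaves)
open import Data.Unit.Base using (⊤; tt)
open import Function.Definitions using (Bijective)
open import Level using (Level; _⊔_) renaming (suc to lsuc)
open import Relation.Binary.Core using (Rel)
open import Relation.Binary.Definitions using (DecidableEquality)
open import Relation.Binary.PropositionalEquality using (_≡_; _≢_; cong; sym)
open import Relation.Nullary.Decidable using (_×-dec_)

------------------------------------------------------------------------
-- Arrangements of brackets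

-- An arrangement of brackets in an n-fold product is a binary tree with
-- n leaves.

Bracketing : Set
Bracketing = Tree ⊤ ⊤

ofHeight≤ : ℕ → List Bracketing
ofHeight≤ zero    = leaf tt ∷ []
ofHeight≤ (suc h) = leaf tt ∷ cartesianProductWith (λ s t → node s tt t) (ofHeight≤ h) (ofHeight≤ h)

-- A binary tree with n leaves has height less than n, so every
-- arrangement occurs here, and exactly once.

bracketings : ℕ → List Bracketing
bracketings n = filter (λ t → #leaves t ℕ.≟ n) (ofHeight≤ n)

-- catalan m is C_{m+1} = (2m)! / ((m+1)! m!), the number of arrangements
-- of brackets in an (m+1)-fold product.

catalan : ℕ → ℕ
catalan m = ((2 ℕ.* m) ! ℕ./ (suc m ! ℕ.* m !)) {{ suc m ℕ.!* m !≢0 }}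

private
  [1+m]!*m!≤[2*m]! : ∀ m → suc m ! ℕ.* m ! ℕ.≤ (2 ℕ.* m) !
  [1+m]!*m!≤[2*m]! zero    = ℕ.≤-refl
  [1+m]!*m!≤[2*m]! (suc m) = begin
    (suc (suc m) ℕ.* suc m !) ℕ.* (suc m ℕ.* m !)
      ≡⟨ ℕ.[m*n]*[o*p]≡[m*o]*[n*p] (suc (suc m)) (suc m !) (suc m) (m !) ⟩
    (suc (suc m) ℕ.* suc m) ℕ.* (suc m ! ℕ.* m !)
      ≤⟨ ℕ.*-mono-≤ (ℕ.*-mono-≤ 2+m≤2+2m (ℕ.s≤s (ℕ.m≤m+n m (m ℕ.+ 0)))) ([1+m]!*m!≤[2*m]! m) ⟩
    (suc (suc (2 ℕ.* m)) ℕ.* suc (2 ℕ.* m)) ℕ.* (2 ℕ.* m) !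
      ≡⟨ ℕ.*-assoc (suc (suc (2 ℕ.* m))) (suc (2 ℕ.* m)) ((2 ℕ.* m) !) ⟩
    suc (suc (2 ℕ.* m)) !
      ≡⟨ cong _! (sym (ℕ.*-suc 2 m)) ⟩
    (2 ℕ.* suc m) ! ∎
    where
    open ℕ.≤-Reasoning
    2+m≤2+2m : suc (suc m) ℕ.≤ suc (suc (2 ℕ.* m))
    2+m≤2+2m = ℕ.s≤s (ℕ.s≤s (ℕ.m≤m+n m (m ℕ.+ 0)))

catalan≢0 : ∀ m → ℕ.NonZero (catalan m)
catalan≢0 m = ℕ.>-nonZero (ℕ.m≥n⇒m/n>0 {{ suc m ℕ.!* m !≢0 }} ([1+m]!*m!≤[2*m]! m))

------------------------------------------------------------------------
-- Permutations and subdiagonals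

permutations : ∀ n → List (Permutation′ n)
permutations zero    = id ∷ []
permutations (suc n) = cartesianProductWith (insert Fin.zero) (allFin (suc n)) (permutations n)

inversions : ∀ {n} → Permutation′ n → ℕ
inversions {n} σ =
  length (filter (λ (i , j) → (i Fin.<? j) ×-dec ((σ ⟨$⟩ʳ j) Fin.<? (σ ⟨$⟩ʳ i)))
                 (cartesianProduct (allFin n) (allFin n)))

-- S 0ℙ n consists of the even permutations and S 1ℙ n of the odd ones.

S : Parity → ∀ n → List (Permutation′ n)
S p n = filter (λ σ → ℕ.parity (inversions σ) Parity.≟ p) (permutations n)

-- The sublists of length k; those of allFin n are the increasing
-- sequences i₁ < … < i_k.

choose : ∀ {a} {A : Set a} → ℕ → List A → List (List A)
choose zero    _        = [] ∷ []
choose (suc k) []       = []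
choose (suc k) (x ∷ xs) = List.map (x ∷_) (choose k xs) ++ choose (suc k) xs

Subdiagonal : ℕ → Set
Subdiagonal n = List (Fin n × Fin n)

subdiagonal : ∀ {n} → Permutation′ n → List (Fin n) → Subdiagonal n
subdiagonal σ rows = List.map (λ i → i , σ ⟨$⟩ʳ i) rows

_≟ˢ_ : ∀ {n} → DecidableEquality (Subdiagonal n)
_≟ˢ_ = List.≡-dec (Product.≡-dec Fin._≟_ Fin._≟_)

-- Different permutations may share a subdiagonal, which is to be counted
-- once.

L : Parity → ∀ n → ℕ → List (Subdiagonal n)
L p n k = deduplicate _≟ˢ_ (cartesianProductWith subdiagonal (S p n) (choose k (allFin n)))

------------------------------------------------------------------------
-- Rings, not necessarily unital or associative

record NonAssociativeRng c ℓ : Set (lsuc (c ⊔ ℓ)) where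
  infix  8 -_
  infixl 7 _*_
  infixl 6 _+_
  infix  4 _≈_
  field
    Carrier          : Set c
    _≈_              : Rel Carrier ℓ
    _+_              : Op₂ Carrier
    _*_              : Op₂ Carrier
    -_               : Op₁ Carrier
    0#               : Carrier
    +-isAbelianGroup : IsAbelianGroup _≈_ _+_ 0# -_
    *-cong           : AlgebraDefinitions.Congruent₂ _≈_ _*_
    distrib          : AlgebraDefinitions._DistributesOver_ _≈_ _*_ _+_

  +-abelianGroup : AbelianGroup c ℓ
  +-abelianGroup = record { isAbelianGroup = +-isAbelianGroup }

  open IsAbelianGroup +-isAbelianGroup public using (_-_)
  open RawMonoidDefinitions (AbelianGroup.rawMonoid +-abelianGroup) public
    using (sum) renaming (_×_ to _·ℕ_)

  infixr 8 _·ℤ_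
  _·ℤ_ : ℤ → Carrier → Carrier
  (ℤ.+ m)    ·ℤ x = m ·ℕ x
  ℤ.-[1+ m ] ·ℤ x = - (suc m ·ℕ x)

  WithDivisionByIntegers : Set (c ⊔ ℓ)
  WithDivisionByIntegers = ∀ m → m ≢ ℤ.0ℤ → Bijective _≈_ _≈_ (m ·ℤ_)

  sumOver : ∀ {a} {A : Set a} → List A → (A → Carrier) → Carrier
  sumOver xs f = List.foldr _+_ 0# (List.map f xs)

  bracketed : Carrier → Bracketing → Carrier
  bracketed a = foldr (λ x _ y → x * y) (λ _ → a)

  AssociativePowers : Set (c ⊔ ℓ)
  AssociativePowers = ∀ a s t → #leaves s ≡ #leaves t → bracketed a s ≈ bracketed a t

  infixr 8 _^1+_
  _^1+_ : Carrier → ℕ → Carrier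
  a ^1+ zero  = a
  a ^1+ suc m = a * (a ^1+ m)

  Matrix : ℕ → Set c
  Matrix n = Fin n → Fin n → Carrier

  su : ∀ {n} → Matrix n → Subdiagonal n → Carrier
  su A l = sumOver l (λ (i , j) → A i j)

record DivisibleRng c ℓ : Set (lsuc (c ⊔ ℓ)) where
  field
    rng      : NonAssociativeRng c ℓ
    division : NonAssociativeRng.WithDivisionByIntegers rng

  open NonAssociativeRng rng

  1/_of_ : ∀ m .{{_ : ℕ.NonZero m}} → Carrier → Carrier
  1/ m of x = proj₁ (proj₂ (division (ℤ.+ m) (λ eq → ℕ.≢-nonZero⁻¹ m (cong ℤ.∣_∣ eq))) x)

  -- Ass m a is Ass(a^{m+1}).
  Ass : ℕ → Carrier → Carrier
  Ass m a = 1/_of_ (catalan m) {{catalan≢0 m}} (sumOver (bracketings (suc m)) (bracketed a))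

  -- pow m a plays the role of a^{m+1}.
  edetWith : (ℕ → Carrier → Carrier) → ∀ {m} → Matrix (suc m) → Carrier
  edetWith pow {m} A =
    - 1/_of_ (n !) {{n ℕ.!≢0}}
        (Σsuⁿ (L 0ℙ n m) - Σsuⁿ (L 1ℙ n m) + Σsuⁿ (L 1ℙ n n) - Σsuⁿ (L 0ℙ n n))
    where
    n : ℕ
    n = suc m
    Σsuⁿ : List (Subdiagonal n) → Carrier
    Σsuⁿ ls = sumOver ls (λ l → pow m (su A l))

  -- Over 𝒦: here powers are associative, so that the bracketing chosen in
  -- _^1+_ is immaterial.
  edet : ∀ {m} → Matrix (suc m) → Carrier
  edet = edetWith (λ m a → a ^1+ m)

  -- Over 𝔎.
  edetAss : ∀ {m} → Matrix (suc m) → Carrier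
  edetAss = edetWith Ass

open DivisibleRng public using (rng; edet; edetAss)
open NonAssociativeRng public using (AssociativePowers)

------------------------------------------------------------------------
-- Properties of a function of nonempty square matrices

module _ {c ℓ} (R : NonAssociativeRng c ℓ) where
  open NonAssociativeRng R hiding (AssociativePowers)

  infix 10 _ᵀ
  _ᵀ : ∀ {n} → Matrix n → Matrix n
  (A ᵀ) i j = A j i

  minor : ∀ {n} → Fin (suc n) → Fin (suc n) → Matrix (suc n) → Matrix n
  minor i j A r s = A (punchIn i r) (punchIn j s)

  _⊛_ : ∀ {n} → Matrix n → Matrix n → Matrix n
  (A ⊛ B) i j = sum (λ k → A i k * B k j)

  -- signed k x is (-1)^k x.
  signed : ℕ → Carrier → Carrier
  signed zero    x = x
  signed (suc k) x = - signed k x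

  module _ (det : ∀ {m} → Matrix (suc m) → Carrier) where

    AntisymmetricInRows : Set _
    AntisymmetricInRows = ∀ m (A : Matrix (suc m)) i j → i ≢ j →
      det (λ r s → A (transpose i j r) s) ≈ - det A

    AntisymmetricInColumns : Set _
    AntisymmetricInColumns = ∀ m (A : Matrix (suc m)) i j → i ≢ j →
      det (λ r s → A r (transpose i j s)) ≈ - det A

    VanishesOnZeroRow : Set _
    VanishesOnZeroRow = ∀ m (A : Matrix (suc m)) i →
      (∀ s → A i s ≈ 0#) → det A ≈ 0#

    VanishesOnZeroColumn : Set _
    VanishesOnZeroColumn = ∀ m (A : Matrix (suc m)) j →
      (∀ r → A r j ≈ 0#) → det A ≈ 0#

    VanishesOnEqualRows : Set _
    VanishesOnEqualRows = ∀ m (A : Matrix (suc m)) i j → i ≢ j →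
      (∀ s → A i s ≈ A j s) → det A ≈ 0#

    VanishesOnEqualColumns : Set _
    VanishesOnEqualColumns = ∀ m (A : Matrix (suc m)) i j → i ≢ j →
      (∀ r → A r i ≈ A r j) → det A ≈ 0#

    TransposeInvariant : Set _
    TransposeInvariant = ∀ m (A : Matrix (suc m)) → det A ≈ det (A ᵀ)

    -- With indices counted from 0 the sum of the two indices has the same
    -- parity as with indices counted from 1.

    LaplaceAlongRows : Set _
    LaplaceAlongRows = ∀ m (A : Matrix (suc (suc m))) i →
      det A ≈ sum (λ j → signed (toℕ i ℕ.+ toℕ j) (A i j * det (minor i j A)))

    LaplaceAlongColumns : Set _
    LaplaceAlongColumns = ∀ m (A : Matrix (suc (suc m))) j →
      det A ≈ sum (λ i → signed (toℕ i ℕ.+ toℕ j) (A i j * det (minor i j A)))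

    -- edet and edetAss are in fact polyadditive: expanding su(l)^n, the
    -- products involving fewer than n matrix entries cancel. Polyadditivity
    -- can therefore fail only jointly with the other formulas.

    PolyadditiveInRows : Set _
    PolyadditiveInRows = ∀ m (A B C : Matrix (suc m)) i →
      (∀ s → A i s ≈ B i s + C i s) →
      (∀ r → r ≢ i → ∀ s → A r s ≈ B r s × A r s ≈ C r s) →
      det A ≈ det B + det C

    PolyadditiveInColumns : Set _
    PolyadditiveInColumns = ∀ m (A B C : Matrix (suc m)) j →
      (∀ r → A r j ≈ B r j + C r j) →
      (∀ s → s ≢ j → ∀ r → A r s ≈ B r s × A r s ≈ C r s) →
      det A ≈ det B + det C

    Multiplicative : Set _
    Multiplicative = ∀ m (A B : Matrix (suc m)) → det (A ⊛ B) ≈ det A * det B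

{-# OPTIONS --safe #-}

-- A subdiagonal of length n or n − 1 lies on exactly one diagonal. Hence, writing d(σ) for the sum of
-- the diagonal of σ and P for the n-th power, edet(A) is -1/n! times the sum over all σ of
--   sgn(σ) (Σᵣ P(d(σ) − a_{rσ(r)}) − P(d(σ))),
-- and everything positive holds for an arbitrary function P: interchanging two rows is the
-- substitution σ ↦ σ ∘ (i j), transposing A is σ ↦ σ⁻¹, and equal rows give edet(A) = - edet(A).
-- For a 2 × 2 diagonal matrix edet(diag(x,y)) = (xy + yx)/2. So if xy ≠ yx, the Laplace formulas fail
-- for diag(x,y), and multiplicativity fails for diag(1,x) diag(y,1) = diag(y,x).

module Submission where

open import Defs
open import Data.Product.Base using (_×_)
open import Level using (0ℓ)
open import Relation.Nullary.Negation.Core using (¬_)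

open import Algebra.Bundles using (AbelianGroup; Semiring)
open import Algebra.Construct.DirectProduct using (abelianGroup)
open import Algebra.Definitions using (Associative)
import Algebra.Properties.AbelianGroup as AbelianGroupProperties
import Algebra.Properties.CommutativeMonoid.Sum as CommutativeMonoidSum
import Algebra.Properties.CommutativeSemigroup as CommutativeSemigroupProperties
import Algebra.Properties.Semiring.Sum as SemiringSum
open import Data.Bool.Base using (Bool; true; false; _∧_; if_then_else_)
open import Data.Empty using (⊥)
open import Data.Fin.Base as Fin using (Fin; zero; suc; punchIn; punchOut)
open import Data.Fin.Patterns using (0F; 1F)
open import Data.Fin.Permutation using (Permutation′; _⟨$⟩ʳ_; _⟨$⟩ˡ_; inverseˡ; inverseʳ; flip; _∘ₚ_)
import Data.Fin.Permutation as Perm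
open import Data.Fin.Permutation.Components using (transpose; transpose-inverse)
import Data.Fin.Properties as Fin
open import Data.Integer.Base as ℤ using (ℤ)
open import Data.List.Base as List
  using (List; []; _∷_; _++_; [_]; length; filter; tabulate; allFin; cartesianProduct;
         cartesianProductWith; deduplicate)
open import Data.List.Membership.Propositional using (_∈_)
import Data.List.Membership.Propositional.Properties as Membership
import Data.List.Membership.Setoid as SetoidMembership
import Data.List.Membership.Setoid.Properties as SetoidMembershipₚ
import Data.List.Properties as List
import Data.List.Relation.Binary.Permutation.Setoid as SetoidPermutation
import Data.List.Relation.Binary.Permutation.Setoid.Properties as SetoidPermutationₚ
open import Data.List.Relation.Unary.All using ([]; _∷_)
import Data.List.Relation.Unary.All.Properties as All
open import Data.List.Relation.Unary.AllPairs using ([]; _∷_)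
open import Data.List.Relation.Unary.Any as Any using (here; there)
open import Data.List.Relation.Unary.Unique.Propositional using (Unique)
import Data.List.Relation.Unary.Unique.Propositional.Properties as Unique
import Data.List.Relation.Unary.Unique.Setoid as SetoidUnique
import Data.List.Relation.Unary.Unique.Setoid.Properties as SetoidUniqueₚ
open import Data.Nat.Base as ℕ using (ℕ; zero; suc; s≤s; _!)
import Data.Nat.Properties as ℕ
open import Data.Parity.Base as ℙ using (Parity; 0ℙ; 1ℙ; _⁻¹)
import Data.Parity.Properties as ℙ
open import Data.Product.Base using (_,_; proj₁; proj₂; ∃)
open import Data.Rational.Base as ℚ using (ℚ; 0ℚ; 1ℚ)
import Data.Rational.Properties as ℚ
open import Data.Rational.Solver using (module +-*-Solver)
open import Data.Sum.Base using (inj₁; inj₂)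
open import Data.Tree.Binary using (leaf; node; #leaves; #nodes)
open import Function.Base using (_∘_; id)
open import Relation.Binary.Bundles using (Setoid)
open import Relation.Binary.Definitions using (DecidableEquality; tri<; tri≈; tri>)
open import Relation.Binary.PropositionalEquality as ≡ using (_≡_; _≢_; cong)
import Relation.Binary.Reasoning.Setoid as SetoidReasoning
open import Relation.Nullary.Decidable using (Dec; does; yes; no; ¬?; dec-true; dec-false)
open import Relation.Nullary.Negation using (contradiction)
open import Relation.Unary using (Pred; Decidable)

-- The definitions are computational: the sign comes from counting inversions in a list, and
-- subdiagonals are lists with duplicates removed. The two substitutions therefore need facts about
-- these lists. That a transposition reverses parity and inversion preserves it is derived by
-- reading the inversion count modulo 2 as a double sum over the two-element field, where symmetric
-- terms cancel. Permutations are compared pointwise, so a substitution is a rearrangement of lists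
-- over a setoid, and every summand has to respect that equality. The two kinds of ring differ only
-- in `P`, so one argument serves both. The counterexample needs noncommuting elements in a
-- divisible ring in which closed terms evaluate. Upper triangular rational 2 × 2 matrices suffice:
-- `E₁₁` times `E₁₂` is `E₁₂`, whereas `E₁₂` times `E₁₁` is 0. In the 2 × 2 examples the averaged
-- powers are ordinary squares, so the same matrices refute both versions.

-- Parity of a permutation as a double sum over the two-element field.

module InversionParity where
  -- In Data.Parity.Base _+_ and _*_ have the same precedence.
  open Semiring ℙ.+-*-semiring using (_+_; _*_)
  open SemiringSum ℙ.+-*-semiring
    using (sum; sum-cong-≗; sum-replicate-zero; sum-remove; ∑-distrib-+; sum-permute)
  open ≡ using (refl; sym; trans; cong₂; module ≡-Reasoning)

  ⟨$⟩ʳ-injective : ∀ {n} (σ : Permutation′ n) {i j} → σ ⟨$⟩ʳ i ≡ σ ⟨$⟩ʳ j → i ≡ j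
  ⟨$⟩ʳ-injective σ eq = trans (sym (inverseˡ σ)) (trans (cong (σ ⟨$⟩ˡ_) eq) (inverseˡ σ))

  transpose-≡ˡ : ∀ {n} (i j : Fin n) → transpose i j i ≡ j
  transpose-≡ˡ i j rewrite dec-true (i Fin.≟ i) refl = refl

  transpose-≡ʳ : ∀ {n} (i j : Fin n) → transpose i j j ≡ i
  transpose-≡ʳ i j with j Fin.≟ i
  ... | yes j≡i = j≡i
  ... | no  _ rewrite dec-true (j Fin.≟ j) refl = refl

  transpose-≢ : ∀ {n} {i j k : Fin n} → k ≢ i → k ≢ j → transpose i j k ≡ k
  transpose-≢ {i = i} {j} {k} k≢i k≢j
    rewrite dec-false (k Fin.≟ i) k≢i | dec-false (k Fin.≟ j) k≢j = refl

  transpose-comm : ∀ {n} (i j k : Fin n) → transpose i j k ≡ transpose j i k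
  transpose-comm i j k = cases (k Fin.≟ i) (k Fin.≟ j)
    where
    cases : Dec (k ≡ i) → Dec (k ≡ j) → transpose i j k ≡ transpose j i k
    cases (yes refl) _          = trans (transpose-≡ˡ k j) (sym (transpose-≡ʳ j k))
    cases (no _)     (yes refl) = trans (transpose-≡ʳ i k) (sym (transpose-≡ˡ k i))
    cases (no k≢i)   (no k≢j)   = trans (transpose-≢ k≢i k≢j) (sym (transpose-≢ k≢j k≢i))

  transpose-involutive : ∀ {n} (i j k : Fin n) → transpose i j (transpose i j k) ≡ k
  transpose-involutive i j k = trans (cong (transpose i j) (transpose-comm i j k)) (transpose-inverse i j)

  toParity : Bool → Parity
  toParity b = if b then 1ℙ else 0ℙ

  -- The order enters as a 0/1 coefficient in the two-element field, so that conditions on pairs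
  -- become products and counting modulo 2 becomes summation.
  lt : ∀ {n} → Fin n → Fin n → Parity
  lt i j = toParity (does (i Fin.<? j))

  lt-irrefl : ∀ {n} (i : Fin n) → lt i i ≡ 0ℙ
  lt-irrefl i = cong toParity (dec-false (i Fin.<? i) (Fin.<-irrefl refl))

  lt-total : ∀ {n} {i j : Fin n} → i ≢ j → lt i j ≡ lt j i ⁻¹
  lt-total {i = i} {j} i≢j with Fin.<-cmp i j
  ... | tri< i<j _ j≮i = trans (cong toParity (dec-true (i Fin.<? j) i<j))
                               (sym (cong (_⁻¹ ∘ toParity) (dec-false (j Fin.<? i) j≮i)))
  ... | tri≈ _ i≡j _   = contradiction i≡j i≢j
  ... | tri> i≮j _ j<i = trans (cong toParity (dec-false (i Fin.<? j) i≮j))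
                               (sym (cong (_⁻¹ ∘ toParity) (dec-true (j Fin.<? i) j<i)))

  lt-asym : ∀ {n} (i j : Fin n) → lt i j * lt j i ≡ 0ℙ
  lt-asym i j with i Fin.≟ j
  ... | yes refl = trans (ℙ.*-idem _) (lt-irrefl i)
  ... | no i≢j   = trans (cong (_* lt j i) (lt-total i≢j)) (ℙ.p⁻¹*p≡0ℙ (lt j i))

  sum-zero : ∀ {n} {f : Fin n → Parity} → (∀ i → f i ≡ 0ℙ) → sum f ≡ 0ℙ
  sum-zero {n} f≡0 = trans (sum-cong-≗ f≡0) (sum-replicate-zero n)

  sum-single : ∀ {n} (i : Fin n) {f : Fin n → Parity} → (∀ j → j ≢ i → f j ≡ 0ℙ) → sum f ≡ f i
  sum-single {suc n} i {f} f≡0 = trans (sum-remove f)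
    (trans (cong (f i +_) (sum-zero (λ j → f≡0 (punchIn i j) (Fin.punchInᵢ≢i i j)))) (ℙ.+-identityʳ (f i)))

  sum-pair : ∀ {n} {i j : Fin n} → i ≢ j → {f : Fin n → Parity} →
             (∀ k → k ≢ i → k ≢ j → f k ≡ 0ℙ) → sum f ≡ f i + f j
  sum-pair {suc n} {i} {j} i≢j {f} f≡0 = trans (sum-remove f) (cong (f i +_)
    (trans (sum-single (punchOut i≢j) (λ k k≢ → f≡0 (punchIn i k) (Fin.punchInᵢ≢i i k)
             (λ eq → k≢ (Fin.punchIn-injective i k _ (trans eq (sym (Fin.punchIn-punchOut i≢j)))))))
           (cong f (Fin.punchIn-punchOut i≢j))))

  ∑∑ : ∀ {n} → (Fin n → Fin n → Parity) → Parity
  ∑∑ w = sum (λ i → sum (w i))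

  ∑∑-cong : ∀ {n} {v w : Fin n → Fin n → Parity} → (∀ i j → v i j ≡ w i j) → ∑∑ v ≡ ∑∑ w
  ∑∑-cong eq = sum-cong-≗ (λ i → sum-cong-≗ (eq i))

  ∑∑-+ : ∀ {n} (v w : Fin n → Fin n → Parity) → ∑∑ (λ i j → v i j + w i j) ≡ ∑∑ v + ∑∑ w
  ∑∑-+ v w = trans (sum-cong-≗ (λ i → ∑-distrib-+ (v i) (w i))) (∑-distrib-+ (sum ∘ v) (sum ∘ w))

  ∑∑-permute : ∀ {n} (w : Fin n → Fin n → Parity) (π : Permutation′ n) →
               ∑∑ w ≡ ∑∑ (λ i j → w (π ⟨$⟩ʳ i) (π ⟨$⟩ʳ j))
  ∑∑-permute w π = trans (sum-permute (λ i → sum (w i)) π) (sum-cong-≗ (λ i → sum-permute (w (π ⟨$⟩ʳ i)) π))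

  -- The terms at `(i , j)` and `(j , i)` are equal and cancel in characteristic 2; only the
  -- diagonal survives. In the induction, `r` is at once the first row and the first column without
  -- their corner.
  ∑∑-symmetric : ∀ {n} (w : Fin n → Fin n → Parity) → (∀ i j → w i j ≡ w j i) →
                 ∑∑ w ≡ sum (λ i → w i i)
  ∑∑-symmetric {zero}  w w-sym = refl
  ∑∑-symmetric {suc n} w w-sym = begin
    (w zero zero + r) + sum (λ i → w (suc i) zero + sum (λ j → w (suc i) (suc j)))
      ≡⟨ cong ((w zero zero + r) +_) (∑-distrib-+ (λ i → w (suc i) zero) _) ⟩
    (w zero zero + r) + (sum (λ i → w (suc i) zero) + ∑∑ (λ i j → w (suc i) (suc j)))
      ≡⟨ cong₂ (λ x y → (w zero zero + r) + (x + y)) (sum-cong-≗ (λ i → w-sym (suc i) zero))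
               (∑∑-symmetric (λ i j → w (suc i) (suc j)) (λ i j → w-sym (suc i) (suc j))) ⟩
    (w zero zero + r) + (r + d)
      ≡⟨ ℙ.+-assoc (w zero zero) r (r + d) ⟩
    w zero zero + (r + (r + d))
      ≡⟨ cong (w zero zero +_) (trans (sym (ℙ.+-assoc r r d)) (cong (_+ d) (ℙ.p+p≡0ℙ r))) ⟩
    w zero zero + d ∎
    where
    open ≡-Reasoning
    r = sum (λ j → w zero (suc j))
    d = sum (λ i → w (suc i) (suc i))

  -- The number of inversions modulo 2, in a form that can be reindexed by permutations. It takes a
  -- bare function, so that it visibly depends on values only.
  inversionParity : ∀ {n} → (Fin n → Fin n) → Parity
  inversionParity f = ∑∑ (λ i j → lt i j * lt (f j) (f i))

  inversionParity-cong : ∀ {n} {f g : Fin n → Fin n} → (∀ i → f i ≡ g i) → inversionParity f ≡ inversionParity g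
  inversionParity-cong eq = ∑∑-cong (λ i j → cong₂ (λ a b → lt i j * lt a b) (eq j) (eq i))

  inversionParity-id : ∀ {n} → inversionParity {n} id ≡ 0ℙ
  inversionParity-id {n} = sum-zero {n} (λ i → sum-zero (lt-asym i))

  -- Both sides sum c over the unordered pairs.
  ∑∑-tournament : ∀ {n} (u c : Fin n → Fin n → Parity) →
                  (∀ {i j} → i ≢ j → u i j ≡ u j i ⁻¹) →
                  (∀ i j → c i j ≡ c j i) → (∀ i → c i i ≡ 0ℙ) →
                  ∑∑ (λ i j → u i j * c i j) ≡ ∑∑ (λ i j → lt i j * c i j)
  ∑∑-tournament u c u-total c-sym c-diag = ℙ.+-cancelʳ-≡ (∑∑ (λ i j → lt i j * c i j)) _ _ (begin
    ∑∑ (λ i j → u i j * c i j) + ∑∑ (λ i j → lt i j * c i j)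
      ≡⟨ ∑∑-+ (λ i j → u i j * c i j) (λ i j → lt i j * c i j) ⟨
    ∑∑ (λ i j → u i j * c i j + lt i j * c i j)
      ≡⟨ ∑∑-symmetric _ w-sym ⟩
    sum (λ i → u i i * c i i + lt i i * c i i)
      ≡⟨ sum-zero (λ i → trans (cong (λ x → u i i * x + lt i i * x) (c-diag i))
                               (cong₂ _+_ (ℙ.*-zeroʳ (u i i)) (ℙ.*-zeroʳ (lt i i)))) ⟩
    0ℙ
      ≡⟨ ℙ.p+p≡0ℙ (∑∑ (λ i j → lt i j * c i j)) ⟨
    ∑∑ (λ i j → lt i j * c i j) + ∑∑ (λ i j → lt i j * c i j) ∎)
    where
    open ≡-Reasoning
    -- Exchanging `i` and `j` complements both coefficients, which adds `c` twice, hence nothing.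
    both : ∀ p q c → p ⁻¹ * c + q ⁻¹ * c ≡ p * c + q * c
    both 0ℙ 0ℙ c = ℙ.p+p≡0ℙ c
    both 0ℙ 1ℙ c = ℙ.+-identityʳ c
    both 1ℙ 0ℙ c = sym (ℙ.+-identityʳ c)
    both 1ℙ 1ℙ c = sym (ℙ.p+p≡0ℙ c)
    w-sym : ∀ i j → u i j * c i j + lt i j * c i j ≡ u j i * c j i + lt j i * c j i
    w-sym i j with i Fin.≟ j
    ... | yes refl = refl
    ... | no i≢j   = trans (cong₂ (λ x y → x * c i j + y * c i j) (u-total i≢j) (lt-total i≢j))
                           (trans (both (u j i) (lt j i) (c i j)) (cong (λ x → u j i * x + lt j i * x) (c-sym i j)))

  -- c i j says whether σ exchanges the order of i and j, hence depends only on {i , j}.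
  inversionParity-∘ₚ : ∀ {n} (τ σ : Permutation′ n) →
    inversionParity (τ ∘ₚ σ ⟨$⟩ʳ_) ≡ inversionParity (σ ⟨$⟩ʳ_) + inversionParity (τ ⟨$⟩ʳ_)
  inversionParity-∘ₚ τ σ = begin
    ∑∑ (λ i j → lt i j * lt (s (t j)) (s (t i)))
      -- `lt (t j) (t i)` is added twice: one copy completes `c (t i) (t j)`, the other counts the
      -- inversions of `τ`.
      ≡⟨ ∑∑-cong (λ i j → expand (lt i j) (lt (s (t j)) (s (t i))) (lt (t j) (t i))) ⟩
    ∑∑ (λ i j → lt i j * c (t i) (t j) + lt i j * lt (t j) (t i))
      ≡⟨ ∑∑-+ (λ i j → lt i j * c (t i) (t j)) _ ⟩
    ∑∑ (λ i j → lt i j * c (t i) (t j)) + inversionParity t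
      ≡⟨ cong (_+ inversionParity t) (begin
        ∑∑ (λ i j → lt i j * c (t i) (t j))
          ≡⟨ ∑∑-permute (λ i j → lt i j * c (t i) (t j)) (flip τ) ⟩
        ∑∑ (λ i j → lt (t⁻¹ i) (t⁻¹ j) * c (t (t⁻¹ i)) (t (t⁻¹ j)))
          ≡⟨ ∑∑-cong (λ i j → cong₂ (λ x y → lt (t⁻¹ i) (t⁻¹ j) * c x y) (inverseʳ τ) (inverseʳ τ)) ⟩
        ∑∑ (λ i j → lt (t⁻¹ i) (t⁻¹ j) * c i j)
          -- The order pulled back along `t⁻¹` still selects exactly one of `(i , j)` and `(j , i)`,
          -- so it may be replaced by the standard order.
          ≡⟨ ∑∑-tournament (λ i j → lt (t⁻¹ i) (t⁻¹ j)) c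
               (λ i≢j → lt-total (i≢j ∘ ⟨$⟩ʳ-injective (flip τ)))
               c-sym
               (λ i → cong₂ _+_ (lt-irrefl (s i)) (lt-irrefl i)) ⟩
        ∑∑ (λ i j → lt i j * c i j)
          -- The second summand of `c i j` is `lt j i`, which `lt i j` annihilates.
          ≡⟨ ∑∑-cong (λ i j → trans (ℙ.*-distribˡ-+ (lt i j) _ _)
               (trans (cong (lt i j * lt (s j) (s i) +_) (lt-asym i j)) (ℙ.+-identityʳ _))) ⟩
        inversionParity s ∎) ⟩
    inversionParity s + inversionParity t ∎
    where
    open ≡-Reasoning
    s = σ ⟨$⟩ʳ_
    t = τ ⟨$⟩ʳ_
    t⁻¹ = τ ⟨$⟩ˡ_
    c : _ → _ → Parity
    c i j = lt (s j) (s i) + lt j i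
    expand : ∀ p q r → p * q ≡ p * (q + r) + p * r
    expand 0ℙ q r = refl
    expand 1ℙ q r = sym (trans (ℙ.+-assoc q r r) (trans (cong (q +_) (ℙ.p+p≡0ℙ r)) (ℙ.+-identityʳ q)))
    both : ∀ p q → p ⁻¹ + q ⁻¹ ≡ p + q
    both 0ℙ 0ℙ = refl
    both 0ℙ 1ℙ = refl
    both 1ℙ 0ℙ = refl
    both 1ℙ 1ℙ = refl
    c-sym : ∀ i j → c i j ≡ c j i
    c-sym i j with i Fin.≟ j
    ... | yes refl = refl
    ... | no i≢j   = trans
      (cong₂ _+_ (lt-total (i≢j ∘ sym ∘ ⟨$⟩ʳ-injective σ))
                 (lt-total (i≢j ∘ sym)))
      (both (lt (s i) (s j)) (lt i j))

  inversionParity-flip : ∀ {n} (σ : Permutation′ n) → inversionParity (flip σ ⟨$⟩ʳ_) ≡ inversionParity (σ ⟨$⟩ʳ_)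
  inversionParity-flip {n} σ = ℙ.+-cancelʳ-≡ (inversionParity (σ ⟨$⟩ʳ_)) _ _ (begin
    inversionParity (flip σ ⟨$⟩ʳ_) + inversionParity (σ ⟨$⟩ʳ_)  ≡⟨ inversionParity-∘ₚ σ (flip σ) ⟨
    inversionParity (σ ∘ₚ flip σ ⟨$⟩ʳ_)                         ≡⟨ inversionParity-cong {n} {g = id} (λ _ → inverseˡ σ) ⟩
    inversionParity {n} id                                      ≡⟨ inversionParity-id {n} ⟩
    0ℙ                                                          ≡⟨ ℙ.p+p≡0ℙ (inversionParity (σ ⟨$⟩ʳ_)) ⟨
    inversionParity (σ ⟨$⟩ʳ_) + inversionParity (σ ⟨$⟩ʳ_)       ∎)
    where open ≡-Reasoning

  -- Substituting j ↦ τ j makes the summand symmetric in i and j, because τ is an involution.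
  inversionParity-transpose : ∀ {n} {i j : Fin n} → i ≢ j → inversionParity (transpose i j) ≡ 1ℙ
  inversionParity-transpose {i = i} {j} i≢j = begin
    ∑∑ (λ a b → lt a b * lt (τ b) (τ a))
      ≡⟨ sum-cong-≗ (λ a → sum-permute (λ b → lt a b * lt (τ b) (τ a)) (Perm.transpose i j)) ⟩
    ∑∑ (λ a b → lt a (τ b) * lt (τ (τ b)) (τ a))
      ≡⟨ ∑∑-cong (λ a b → cong (λ x → lt a (τ b) * lt x (τ a)) (transpose-involutive i j b)) ⟩
    ∑∑ (λ a b → lt a (τ b) * lt b (τ a))
      ≡⟨ ∑∑-symmetric _ (λ a b → ℙ.*-comm (lt a (τ b)) (lt b (τ a))) ⟩
    sum (λ a → lt a (τ a) * lt a (τ a))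
      ≡⟨ sum-cong-≗ (λ a → ℙ.*-idem (lt a (τ a))) ⟩
    sum (λ a → lt a (τ a))
      ≡⟨ sum-pair i≢j (λ k k≢i k≢j → trans (cong (lt k) (transpose-≢ k≢i k≢j)) (lt-irrefl k)) ⟩
    lt i (τ i) + lt j (τ j)
      ≡⟨ cong₂ (λ x y → lt i x + lt j y) (transpose-≡ˡ i j) (transpose-≡ʳ i j) ⟩
    lt i j + lt j i
      ≡⟨ cong (_+ lt j i) (lt-total i≢j) ⟩
    lt j i ⁻¹ + lt j i
      ≡⟨ ℙ.p⁻¹+p≡1ℙ (lt j i) ⟩
    1ℙ ∎
    where
    open ≡-Reasoning
    τ = transpose i j

  parity-length-filter-tabulate : ∀ {a p} {A : Set a} {P : Pred A p} (P? : Decidable P) {n} (f : Fin n → A) →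
    ℕ.parity (length (filter P? (tabulate f))) ≡ sum (λ i → toParity (does (P? (f i))))
  parity-length-filter-tabulate P? {zero}  f = refl
  parity-length-filter-tabulate P? {suc n} f with does (P? (f zero))
  ... | true  = trans (sym (ℙ.⁻¹-selfInverse (ℙ.suc-homo-⁻¹ (length (filter P? (tabulate (f ∘ suc)))))))
                      (cong _⁻¹ (parity-length-filter-tabulate P? (f ∘ suc)))
  ... | false = parity-length-filter-tabulate P? (f ∘ suc)

  parity-length-filter-cartesianProduct :
    ∀ {a b p} {A : Set a} {B : Set b} {P : Pred (A × B) p} (P? : Decidable P)
    {m n} (f : Fin m → A) (g : Fin n → B) →
    ℕ.parity (length (filter P? (cartesianProduct (tabulate f) (tabulate g)))) ≡
    sum (λ i → sum (λ j → toParity (does (P? (f i , g j)))))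
  parity-length-filter-cartesianProduct P? {zero}  f g = refl
  parity-length-filter-cartesianProduct P? {suc m} f g = begin
    ℕ.parity (length (filter P? (row ++ rest)))
      ≡⟨ cong (ℕ.parity ∘ length) (List.filter-++ P? row rest) ⟩
    ℕ.parity (length (filter P? row ++ filter P? rest))
      ≡⟨ cong ℕ.parity (List.length-++ (filter P? row)) ⟩
    ℕ.parity (length (filter P? row) ℕ.+ length (filter P? rest))
      ≡⟨ ℙ.+-homo-+ (length (filter P? row)) _ ⟩
    ℕ.parity (length (filter P? row)) + ℕ.parity (length (filter P? rest))
      ≡⟨ cong₂ _+_
           (trans (cong (ℕ.parity ∘ length ∘ filter P?) (List.map-tabulate g (f zero ,_)))
                  (parity-length-filter-tabulate P? (λ j → f zero , g j)))
           (parity-length-filter-cartesianProduct P? (f ∘ suc) g) ⟩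
    _ ∎
    where
    open ≡-Reasoning
    row  = List.map (f zero ,_) (tabulate g)
    rest = cartesianProduct (tabulate (f ∘ suc)) (tabulate g)

  -- Links the list count to the double sum: the truth value of `_×-dec_` is a conjunction, which
  -- becomes a product of parities.
  parity-inversions : ∀ {n} (σ : Permutation′ n) → ℕ.parity (inversions σ) ≡ inversionParity (σ ⟨$⟩ʳ_)
  parity-inversions {n} σ = trans (parity-length-filter-cartesianProduct _ {n} {n} id id)
    (∑∑-cong {n} (λ i j → toParity-∧ (does (i Fin.<? j)) (does ((σ ⟨$⟩ʳ j) Fin.<? (σ ⟨$⟩ʳ i)))))
    where
    toParity-∧ : ∀ b c → toParity (b ∧ c) ≡ toParity b * toParity c
    toParity-∧ true  c = refl
    toParity-∧ false c = refl

open InversionParity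

-- Rearranging the lists of even and odd permutations; subdiagonals without repetition.

module PermutationLists where
  open ≡ using (refl; sym; trans; cong₂; module ≡-Reasoning)

  module _ {a ℓ} (X : Setoid a ℓ) where
    open Setoid X using (_≈_) renaming (refl to ≈-refl; sym to ≈-sym)
    open SetoidMembership X using () renaming (_∈_ to _∈ˣ_)
    open SetoidUnique X using () renaming (Unique to Uniqueˣ)
    open SetoidPermutation X using (_↭_; ↭-refl; ↭-sym; ↭-trans; ↭-reflexive-≋; prep)
    open SetoidPermutationₚ X using (∈-resp-↭; Unique-resp-↭; shift)

    -- The head of `xs` occurs in `ys` and can be shifted to its front. By uniqueness it occurs in
    -- neither remainder, so the remainders again have the same elements.
    unique∧set⇒↭ : ∀ {xs ys} → Uniqueˣ xs → Uniqueˣ ys →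
                   (∀ {x} → x ∈ˣ xs → x ∈ˣ ys) → (∀ {x} → x ∈ˣ ys → x ∈ˣ xs) → xs ↭ ys
    unique∧set⇒↭ {[]}     {[]}     _ _ _ _ = ↭-refl
    unique∧set⇒↭ {[]}     {y ∷ ys} _ _ _ ys⊆[] with () ← ys⊆[] (here ≈-refl)
    unique∧set⇒↭ {x ∷ xs} {ys} (x∉xs ∷ xs!) ys! xs⊆ys ys⊆xs
      with ps , qs , w , x≈w , ys≋ ← SetoidMembershipₚ.∈-∃++ X (xs⊆ys (here ≈-refl))
      with ys↭ ← ↭-trans (↭-reflexive-≋ ys≋) (shift (≈-sym x≈w) ps qs)
      with x∉zs ∷ zs! ← Unique-resp-↭ ys↭ ys!
      = ↭-trans (prep ≈-refl (unique∧set⇒↭ xs! zs! ⊆ ⊇)) (↭-sym ys↭)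
      where
      ⊆ : ∀ {y} → y ∈ˣ xs → y ∈ˣ ps ++ qs
      ⊆ y∈xs with ∈-resp-↭ ys↭ (xs⊆ys (there y∈xs))
      ... | here y≈x   = contradiction (SetoidMembershipₚ.∈-resp-≈ X y≈x y∈xs) (All.All¬⇒¬Any x∉xs)
      ... | there y∈zs = y∈zs
      ⊇ : ∀ {y} → y ∈ˣ ps ++ qs → y ∈ˣ xs
      ⊇ y∈zs with ys⊆xs (∈-resp-↭ (↭-sym ys↭) (there y∈zs))
      ... | here y≈x   = contradiction (SetoidMembershipₚ.∈-resp-≈ X y≈x y∈zs) (All.All¬⇒¬Any x∉zs)
      ... | there y∈xs = y∈xs

  -- A permutation is a record of functions and proofs, so equal values do not yield a propositional
  -- equality; membership, uniqueness and rearrangement are all taken up to pointwise equality.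
  permutationSetoid : ℕ → Setoid 0ℓ 0ℓ
  permutationSetoid n = record
    { Carrier = Permutation′ n
    ; _≈_ = Perm._≈_
    ; isEquivalence = record
      { refl  = λ _ → refl
      ; sym   = λ σ≈τ i → sym (σ≈τ i)
      ; trans = λ σ≈τ τ≈ρ i → trans (σ≈τ i) (τ≈ρ i)
      }
    }

  module _ {n : ℕ} where
    open SetoidMembership (permutationSetoid n) public using () renaming (_∈_ to _∈ₚ_)
    open SetoidUnique (permutationSetoid n) public using () renaming (Unique to Uniqueₚ)
    open SetoidPermutation (permutationSetoid n) public using () renaming (_↭_ to _↭ₚ_)

  flip-cong : ∀ {n} {σ τ : Permutation′ n} → σ Perm.≈ τ → flip σ Perm.≈ flip τ
  flip-cong {σ = σ} {τ} σ≈τ i = ⟨$⟩ʳ-injective τ (trans (sym (σ≈τ _)) (trans (inverseʳ σ) (sym (inverseʳ τ))))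

  insert-cong : ∀ {n} {i j : Fin (suc n)} {σ τ : Permutation′ n} → i ≡ j → σ Perm.≈ τ →
                Perm.insert zero i σ Perm.≈ Perm.insert zero j τ
  insert-cong refl σ≈τ zero    = refl
  insert-cong {i = i} refl σ≈τ (suc k) = cong (punchIn i) (σ≈τ k)

  insert-injective : ∀ {n} {i j : Fin (suc n)} {σ τ : Permutation′ n} →
                     Perm.insert zero i σ Perm.≈ Perm.insert zero j τ → i ≡ j × σ Perm.≈ τ
  insert-injective {i = i} {σ = σ} {τ} eq with eq zero
  ... | refl = refl , λ k → Fin.punchIn-injective i (σ ⟨$⟩ʳ k) (τ ⟨$⟩ʳ k) (eq (suc k))

  permutations-unique : ∀ n → Uniqueₚ (permutations n)
  permutations-unique zero    = [] ∷ []
  permutations-unique (suc n) = SetoidUniqueₚ.cartesianProductWith⁺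
    (≡.setoid _) (permutationSetoid n) (permutationSetoid (suc n)) (Perm.insert zero)
    (λ {i} {j} {σ} {τ} → insert-injective {σ = σ} {τ})
    (Unique.tabulate⁺ id) (permutations-unique n)

  -- Removing `zero` from `σ` and inserting it again with its old value `σ ⟨$⟩ʳ zero` gives back
  -- `σ`.
  permutations-complete : ∀ {n} (σ : Permutation′ n) → σ ∈ₚ permutations n
  permutations-complete {zero}  σ = here (λ ())
  permutations-complete {suc n} σ = SetoidMembershipₚ.∈-resp-≈ (permutationSetoid (suc n))
    {x = Perm.insert zero (σ ⟨$⟩ʳ zero) (Perm.remove zero σ)} {σ} (Perm.insert-remove zero σ)
    (SetoidMembershipₚ.∈-cartesianProductWith⁺
      (≡.setoid _) (permutationSetoid n) (permutationSetoid (suc n))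
      (λ {i} {j} {σ} {τ} → insert-cong {σ = σ} {τ})
      (Membership.∈-allFin (σ ⟨$⟩ʳ zero)) (permutations-complete (Perm.remove zero σ)))

  S-unique : ∀ p n → Uniqueₚ (S p n)
  S-unique p n = SetoidUniqueₚ.filter⁺ (permutationSetoid n) _ (permutations-unique n)

  parity-inversions-cong : ∀ {n} {σ τ : Permutation′ n} → σ Perm.≈ τ →
                           ℕ.parity (inversions σ) ≡ ℕ.parity (inversions τ)
  parity-inversions-cong {σ = σ} {τ} σ≈τ =
    trans (parity-inversions σ) (trans (inversionParity-cong σ≈τ) (sym (parity-inversions τ)))

  ∈-S⁺ : ∀ {p n} {σ : Permutation′ n} → ℕ.parity (inversions σ) ≡ p → σ ∈ₚ S p n
  ∈-S⁺ {p} {n} {σ} = SetoidMembershipₚ.∈-filter⁺ (permutationSetoid n) (λ σ → ℕ.parity (inversions σ) ℙ.≟ p)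
    (λ {σ} {τ} σ≈τ → trans (sym (parity-inversions-cong {σ = σ} {τ} σ≈τ))) {v = σ} (permutations-complete σ)

  ∈-S⁻ : ∀ {p n} {σ : Permutation′ n} → σ ∈ₚ S p n → ℕ.parity (inversions σ) ≡ p
  ∈-S⁻ {p} {n} {σ} = proj₂ ∘ SetoidMembershipₚ.∈-filter⁻ (permutationSetoid n)
    (λ σ → ℕ.parity (inversions σ) ℙ.≟ p)
    (λ {σ} {τ} σ≈τ → trans (sym (parity-inversions-cong {σ = σ} {τ} σ≈τ))) {v = σ} {permutations n}

  module _ {n} (φ : Permutation′ n → Permutation′ n)
           (φ-cong : ∀ {σ τ} → σ Perm.≈ τ → φ σ Perm.≈ φ τ)
           (φ-involutive : ∀ σ → φ (φ σ) Perm.≈ σ)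
           {p q} (φ-parity : ∀ σ → ℕ.parity (inversions σ) ≡ p → ℕ.parity (inversions (φ σ)) ≡ q)
           (φ-parity⁻ : ∀ σ → ℕ.parity (inversions σ) ≡ q → ℕ.parity (inversions (φ σ)) ≡ p) where

    private
      module P = Setoid (permutationSetoid n)

    -- Being its own inverse makes `φ` injective, so the mapped list has no repetitions, and makes
    -- `φ σ` a preimage of `σ`. The parity hypotheses keep images and preimages in the right class.
    map-S-↭ : List.map φ (S p n) ↭ₚ S q n
    map-S-↭ = unique∧set⇒↭ (permutationSetoid n)
      (SetoidUniqueₚ.map⁺ (permutationSetoid n) (permutationSetoid n)
        (λ {σ} {τ} eq i → trans (sym (φ-involutive σ i)) (trans (φ-cong {φ σ} {φ τ} eq i) (φ-involutive τ i)))
        (S-unique p n))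
      (S-unique q n)
      (λ {σ} σ∈ → let τ , τ∈ , σ≈φτ = SetoidMembershipₚ.∈-map⁻ (permutationSetoid n) (permutationSetoid n)
                                        {v = σ} σ∈ in
        SetoidMembershipₚ.∈-resp-≈ (permutationSetoid n) {x = φ τ} {σ} (P.sym {σ} {φ τ} σ≈φτ)
          (∈-S⁺ {σ = φ τ} (φ-parity τ (∈-S⁻ {σ = τ} τ∈))))
      (λ {σ} σ∈ → SetoidMembershipₚ.∈-resp-≈ (permutationSetoid n) {x = φ (φ σ)} {σ} (φ-involutive σ)
        (SetoidMembershipₚ.∈-map⁺ (permutationSetoid n) (permutationSetoid n)
          (λ {σ} {τ} → φ-cong {σ} {τ}) {v = φ σ}
          (∈-S⁺ {σ = φ σ} (φ-parity⁻ σ (∈-S⁻ {σ = σ} σ∈)))))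

  map-flip-S-↭ : ∀ p n → List.map flip (S p n) ↭ₚ S p n
  map-flip-S-↭ p n = map-S-↭ flip (λ {σ} {τ} → flip-cong {σ = σ} {τ}) (λ _ _ → refl) flip-parity flip-parity
    where
    flip-parity : ∀ σ → ℕ.parity (inversions σ) ≡ p → ℕ.parity (inversions (flip σ)) ≡ p
    flip-parity σ eq = trans (parity-inversions (flip σ))
      (trans (inversionParity-flip σ) (trans (sym (parity-inversions σ)) eq))

  map-transpose-S-↭ : ∀ {n} {i j : Fin n} → i ≢ j → ∀ p →
                      List.map (Perm.transpose i j ∘ₚ_) (S p n) ↭ₚ S (p ⁻¹) n
  map-transpose-S-↭ {n} {i} {j} i≢j p = map-S-↭ (τ ∘ₚ_) (λ eq k → eq _)
    (λ σ k → cong (σ ⟨$⟩ʳ_) (transpose-involutive i j k))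
    (λ σ eq → trans (τ∘ₚ-parity σ) (cong _⁻¹ eq))
    (λ σ eq → trans (τ∘ₚ-parity σ) (trans (cong _⁻¹ eq) (ℙ.⁻¹-involutive p)))
    where
    τ = Perm.transpose i j
    τ∘ₚ-parity : ∀ σ → ℕ.parity (inversions (τ ∘ₚ σ)) ≡ ℕ.parity (inversions σ) ⁻¹
    τ∘ₚ-parity σ = begin
      ℕ.parity (inversions (τ ∘ₚ σ))                             ≡⟨ parity-inversions (τ ∘ₚ σ) ⟩
      inversionParity (τ ∘ₚ σ ⟨$⟩ʳ_)                             ≡⟨ inversionParity-∘ₚ τ σ ⟩
      inversionParity (σ ⟨$⟩ʳ_) ℙ.+ inversionParity (τ ⟨$⟩ʳ_)      ≡⟨ ℙ.+-comm (inversionParity (σ ⟨$⟩ʳ_)) _ ⟩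
      inversionParity (τ ⟨$⟩ʳ_) ℙ.+ inversionParity (σ ⟨$⟩ʳ_) 
        ≡⟨ cong₂ ℙ._+_ (inversionParity-transpose i≢j) (sym (parity-inversions σ)) ⟩
      ℕ.parity (inversions σ) ⁻¹ ∎
      where open ≡-Reasoning

  -- Removes `deduplicate` from `L`, once the underlying list of subdiagonals is known to be free of
  -- repetitions.
  deduplicate-unique : ∀ {a} {X : Set a} (_≟_ : DecidableEquality X) {xs} → Unique xs → deduplicate _≟_ xs ≡ xs
  deduplicate-unique _≟_ {[]}     []           = refl
  deduplicate-unique _≟_ {x ∷ xs} (x∉xs ∷ xs!) = cong (x ∷_)
    (trans (cong (filter (¬? ∘ (x ≟_))) (deduplicate-unique _≟_ xs!)) (List.filter-all (¬? ∘ (x ≟_)) x∉xs))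

  module _ {a} {X : Set a} where

    choose-short : ∀ {k} (xs : List X) → length xs ℕ.≤ k → choose (suc k) xs ≡ []
    choose-short         []       _             = refl
    choose-short {suc k} (x ∷ xs) (s≤s |xs|≤k) =
      cong₂ (λ yss zss → List.map (x ∷_) yss ++ zss) (choose-short xs |xs|≤k) (choose-short xs (ℕ.m≤n⇒m≤1+n |xs|≤k))

    choose-length : ∀ (xs : List X) → choose (length xs) xs ≡ [ xs ]
    choose-length []       = refl
    choose-length (x ∷ xs) =
      cong₂ (λ yss zss → List.map (x ∷_) yss ++ zss) (choose-length xs) (choose-short xs ℕ.≤-refl)

    -- The order of the results is that of `choose`, so that the two agree as lists and not only up
    -- to rearrangement.
    omitOne : List X → List (List X)
    omitOne []       = []
    omitOne (x ∷ xs) = List.map (x ∷_) (omitOne xs) ++ [ xs ]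

    choose-omitOne : ∀ x (xs : List X) → choose (length xs) (x ∷ xs) ≡ omitOne (x ∷ xs)
    choose-omitOne x []       = refl
    choose-omitOne x (y ∷ ys) =
      cong₂ (λ yss zss → List.map (x ∷_) yss ++ zss) (choose-omitOne y ys) (choose-length (y ∷ ys))

    -- For `allFin n` this names the one row a subdiagonal of length n - 1 may miss, as
    -- `subdiagonals-unique` demands.
    ∈-omitOne : ∀ {xs ys : List X} → ys ∈ omitOne xs → ∃ λ x → ∀ {y} → y ∈ xs → y ≢ x → y ∈ ys
    ∈-omitOne {x ∷ xs} ys∈ with Membership.∈-++⁻ (List.map (x ∷_) (omitOne xs)) ys∈
    ... | inj₂ (here refl) = x , λ where
      (here y≡x)   y≢x → contradiction y≡x y≢x
      (there y∈xs) _   → y∈xs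
    ... | inj₁ ys∈map with zs , zs∈ , refl ← Membership.∈-map⁻ (x ∷_) ys∈map
      with z , rest ← ∈-omitOne zs∈ = z , λ where
      (here y≡x)   _   → here y≡x
      (there y∈xs) y≢z → there (rest y∈xs y≢z)

    -- All results but the last begin with `x`, whereas the last one, `xs`, does not contain `x`.
    omitOne-unique : ∀ {xs : List X} → Unique xs → Unique (omitOne xs)
    omitOne-unique {[]}     []           = []
    omitOne-unique {x ∷ xs} (x∉xs ∷ xs!) =
      Unique.++⁺ (Unique.map⁺ List.∷-injectiveʳ (omitOne-unique xs!)) ([] ∷ []) disjoint
      where
      disjoint : ∀ {ys} → ys ∈ List.map (x ∷_) (omitOne xs) × ys ∈ [ xs ] → ⊥
      disjoint (ys∈map , here refl) with zs , _ , refl ← Membership.∈-map⁻ (x ∷_) ys∈map =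
        All.All¬⇒¬Any x∉xs (here refl)

  subdiagonal-agree : ∀ {n} {σ τ : Permutation′ n} {rows rows′} → subdiagonal σ rows ≡ subdiagonal τ rows′ →
                      ∀ {i} → i ∈ rows → σ ⟨$⟩ʳ i ≡ τ ⟨$⟩ʳ i
  subdiagonal-agree {rows = _ ∷ _} {_ ∷ _} eq i∈ with List.∷-injective eq
  subdiagonal-agree {rows = _ ∷ _} {_ ∷ _} eq (here refl)   | eq₁ , _
    with refl ← cong proj₁ eq₁ = cong proj₂ eq₁
  subdiagonal-agree {σ = σ} {τ} {rows = _ ∷ _} {_ ∷ _} eq (there i∈) | _ , eq₂ =
    subdiagonal-agree {σ = σ} {τ} eq₂ i∈

  subdiagonal-rows : ∀ {n} (σ : Permutation′ n) rows → List.map proj₁ (subdiagonal σ rows) ≡ rows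
  subdiagonal-rows σ rows = trans (sym (List.map-∘ rows)) (List.map-id rows)

  -- Let k be the preimage of σ(r) under τ. If k ≠ r, then σ(k) = τ(k) = σ(r) contradicts
  -- injectivity; so k = r, that is, τ(r) = σ(r).
  ≈-except-one : ∀ {n} {σ τ : Permutation′ n} r → (∀ {i} → i ≢ r → σ ⟨$⟩ʳ i ≡ τ ⟨$⟩ʳ i) → σ Perm.≈ τ
  ≈-except-one {σ = σ} {τ} r agree i with i Fin.≟ r
  ... | no i≢r   = agree i≢r
  ... | yes refl with (τ ⟨$⟩ˡ (σ ⟨$⟩ʳ i)) Fin.≟ i
  ...   | yes eq = trans (sym (inverseʳ τ)) (cong (τ ⟨$⟩ʳ_) eq)
  ...   | no ≢i  = contradiction (⟨$⟩ʳ-injective σ (trans (agree ≢i) (inverseʳ τ))) ≢i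

  -- For a fixed permutation the positions determine the rows. A subdiagonal shared by two
  -- permutations makes them agree on all rows but one, hence everywhere, which contradicts the
  -- uniqueness of `σs`.
  subdiagonals-unique : ∀ {n} {σs : List (Permutation′ n)} {rowss} → Uniqueₚ σs → Unique rowss →
                        (∀ {rows} → rows ∈ rowss → ∃ λ r → ∀ {i} → i ≢ r → i ∈ rows) →
                        Unique (cartesianProductWith subdiagonal σs rowss)
  subdiagonals-unique {σs = []}     []           rowss! cofinite = []
  subdiagonals-unique {n} {σs = σ ∷ σs} {rowss} (σ∉σs ∷ σs!) rowss! cofinite = Unique.++⁺
    (Unique.map⁺ (λ {rows} {rows′} eq → trans (sym (subdiagonal-rows σ rows))
                  (trans (cong (List.map proj₁) eq) (subdiagonal-rows σ rows′))) rowss!)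
    (subdiagonals-unique σs! rowss! cofinite)
    disjoint
    where
    disjoint : ∀ {l} → l ∈ List.map (subdiagonal σ) rowss × l ∈ cartesianProductWith subdiagonal σs rowss → ⊥
    disjoint (l∈map , l∈rest) with rows , rows∈ , refl ← Membership.∈-map⁻ (subdiagonal σ) l∈map
      with τ , rows′ , τ∈ , _ , eq ← Membership.∈-cartesianProductWith⁻ subdiagonal σs rowss l∈rest
      with r , r-rest ← cofinite rows∈ =
      All.All¬⇒¬Any σ∉σs (Any.map (λ { refl → ≈-except-one {σ = σ} {τ} r
                                    (λ i≢r → subdiagonal-agree {σ = σ} {τ} eq (r-rest i≢r)) }) τ∈)

  L-full : ∀ p m → L p (suc m) (suc m) ≡ cartesianProductWith subdiagonal (S p (suc m)) [ allFin (suc m) ]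
  L-full p m = trans
    (cong (λ rowss → deduplicate _≟ˢ_ (cartesianProductWith subdiagonal (S p (suc m)) rowss))
      (trans (cong (λ k → choose k (allFin (suc m))) (sym (List.length-tabulate {n = suc m} id)))
             (choose-length (allFin (suc m)))))
    (deduplicate-unique _≟ˢ_ (subdiagonals-unique (S-unique p (suc m)) ([] ∷ [])
      -- No row is missing here, so any row can be named as the exception.
      (λ { (here refl) → zero , λ _ → Membership.∈-allFin _ })))

  -- For `m` = 0 this agrees with the convention for 1 × 1 matrices: omitting the only row leaves
  -- the empty subdiagonal, once for the even identity and never for an odd permutation.
  L-omitOne : ∀ p m → L p (suc m) m ≡ cartesianProductWith subdiagonal (S p (suc m)) (omitOne (allFin (suc m)))
  L-omitOne p m = trans
    (cong (λ rowss → deduplicate _≟ˢ_ (cartesianProductWith subdiagonal (S p (suc m)) rowss))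
      -- Here `m` is the length of the tail `tabulate suc`, as `choose-omitOne` requires, and not of
      -- the whole list.
      (trans (cong (λ k → choose k (allFin (suc m))) (sym (List.length-tabulate {n = m} suc)))
             (choose-omitOne zero (tabulate suc))))
    (deduplicate-unique _≟ˢ_ (subdiagonals-unique (S-unique p (suc m))
      (omitOne-unique (Unique.tabulate⁺ {n = suc m} id))
      (λ rows∈ → let r , rest = ∈-omitOne rows∈ in r , rest (Membership.∈-allFin _))))

open PermutationLists

-- Sums over even and odd permutations, with an arbitrary function as the power.

module Alternating {c ℓ} (R : NonAssociativeRng c ℓ) where
  open NonAssociativeRng R hiding (AssociativePowers; sum; _-_)
  open AbelianGroup +-abelianGroup
    using (setoid; refl; sym; trans; reflexive; commutativeMonoid; isCommutativeMonoid; commutativeSemigroup; _-_)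
    renaming (∙-cong to +-cong; ∙-congˡ to +-congˡ; ∙-congʳ to +-congʳ; assoc to +-assoc; comm to +-comm;
              identityˡ to +-identityˡ; identityʳ to +-identityʳ; ⁻¹-cong to -‿cong)
  open AbelianGroupProperties +-abelianGroup
    using (⁻¹-anti-homo‿-; ε⁻¹≈ε; //-cong₂) renaming (xyx⁻¹≈y to x+y-x≈y)
  open CommutativeMonoidSum commutativeMonoid
    using (sum; sum-cong-≋; sum-permute; sum-remove; ∑-distrib-+)
  open CommutativeSemigroupProperties commutativeSemigroup using (xy∙z≈x∙zy; xy∙z≈xz∙y)
  open SetoidReasoning setoid

  sumOver-map : ∀ {a b} {X : Set a} {Y : Set b} (g : Y → X) ys f → sumOver (List.map g ys) f ≈ sumOver ys (f ∘ g)
  sumOver-map g ys f = reflexive (cong (List.foldr _+_ 0#) (≡.sym (List.map-∘ ys)))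

  module _ {a} {X : Set a} where

    sumOver-cong : ∀ (xs : List X) {f g} → (∀ x → f x ≈ g x) → sumOver xs f ≈ sumOver xs g
    sumOver-cong []       f≈g = refl
    sumOver-cong (x ∷ xs) f≈g = +-cong (f≈g x) (sumOver-cong xs f≈g)

    sumOver-++ : ∀ (xs ys : List X) f → sumOver (xs ++ ys) f ≈ sumOver xs f + sumOver ys f
    sumOver-++ []       ys f = sym (+-identityˡ _)
    sumOver-++ (x ∷ xs) ys f = trans (+-congˡ (sumOver-++ xs ys f)) (sym (+-assoc _ _ _))

    sumOver-tabulate : ∀ {n} (g : Fin n → X) f → sumOver (tabulate g) f ≈ sum (f ∘ g)
    sumOver-tabulate {zero}  g f = refl
    sumOver-tabulate {suc n} g f = +-congˡ (sumOver-tabulate (g ∘ suc) f)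

    sumOver-sum : ∀ (xs : List X) {n} (f : X → Fin n → Carrier) →
                  sumOver xs (λ x → sum (f x)) ≈ sum (λ i → sumOver xs (λ x → f x i))
    sumOver-sum []       {n} f = sym (CommutativeMonoidSum.sum-replicate-zero commutativeMonoid n)
    sumOver-sum (x ∷ xs) f = trans (+-congˡ (sumOver-sum xs f)) (sym (∑-distrib-+ (f x) _))

    sumOver-cartesianProductWith : ∀ {b d} {Y : Set b} {Z : Set d} (_∙_ : Y → Z → X) ys zs f →
      sumOver (cartesianProductWith _∙_ ys zs) f ≈ sumOver ys (λ y → sumOver zs (λ z → f (y ∙ z)))
    sumOver-cartesianProductWith _∙_ []       zs f = refl
    sumOver-cartesianProductWith _∙_ (y ∷ ys) zs f = trans (sumOver-++ (List.map (y ∙_) zs) _ f)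
      (+-cong (sumOver-map (y ∙_) zs f) (sumOver-cartesianProductWith _∙_ ys zs f))

  -- `P` has to vary in the induction: when an element of the tail is omitted, `f x` stays in the
  -- sum and is absorbed into `λ y → P (f x + y)`.
  sumOver-omitOne : ∀ {a} {X : Set a} (P : Carrier → Carrier) → (∀ {x y} → x ≈ y → P x ≈ P y) →
    ∀ (xs : List X) f →
    sumOver (omitOne xs) (λ ys → P (sumOver ys f)) ≈ sumOver xs (λ x → P (sumOver xs f - f x))
  sumOver-omitOne P P-cong []       f = refl
  sumOver-omitOne P P-cong (x ∷ xs) f = begin
    sumOver (List.map (x ∷_) (omitOne xs) ++ [ xs ]) (λ ys → P (sumOver ys f))
      ≈⟨ sumOver-++ (List.map (x ∷_) (omitOne xs)) [ xs ] _ ⟩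
    sumOver (List.map (x ∷_) (omitOne xs)) (λ ys → P (sumOver ys f)) + (P s + 0#)
      -- `omitOne` places the omission of the head last, whereas the right-hand side has it first.
      ≈⟨ +-comm _ _ ⟩
    (P s + 0#) + sumOver (List.map (x ∷_) (omitOne xs)) (λ ys → P (sumOver ys f))
      ≈⟨ +-cong (trans (+-identityʳ _) (P-cong (sym (x+y-x≈y (f x) s)))) (begin
        sumOver (List.map (x ∷_) (omitOne xs)) (λ ys → P (sumOver ys f))
          ≈⟨ sumOver-map (x ∷_) (omitOne xs) _ ⟩
        sumOver (omitOne xs) (λ ys → P (f x + sumOver ys f))
          ≈⟨ sumOver-omitOne (λ y → P (f x + y)) (P-cong ∘ +-congˡ) xs f ⟩
        sumOver xs (λ y → P (f x + (s - f y)))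
          ≈⟨ sumOver-cong xs (λ y → P-cong (sym (+-assoc (f x) s (- f y)))) ⟩
        sumOver xs (λ y → P (f x + s - f y)) ∎) ⟩
    P (f x + s - f x) + sumOver xs (λ y → P (f x + s - f y)) ∎
    where s = sumOver xs f

  sumOver-↭ₚ : ∀ {n} {σs τs : List (Permutation′ n)} → σs ↭ₚ τs → ∀ f →
               (∀ {σ τ} → σ Perm.≈ τ → f σ ≈ f τ) → sumOver σs f ≈ sumOver τs f
  sumOver-↭ₚ {n} σs↭τs f f-cong = SetoidPermutationₚ.foldr-commMonoid setoid isCommutativeMonoid
    (SetoidPermutationₚ.map⁺ (permutationSetoid n) setoid (λ {σ} {τ} → f-cong {σ} {τ}) σs↭τs)

  sumOver-S-transpose : ∀ {n} {i j : Fin n} → i ≢ j → ∀ p (f : Permutation′ n → Carrier) →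
    (∀ {σ τ} → σ Perm.≈ τ → f σ ≈ f τ) →
    sumOver (S p n) (λ σ → f (Perm.transpose i j ∘ₚ σ)) ≈ sumOver (S (p ⁻¹) n) f
  sumOver-S-transpose {n} {i} {j} i≢j p f f-cong = trans
    (sym (sumOver-map (Perm.transpose i j ∘ₚ_) (S p n) f))
    (sumOver-↭ₚ (map-transpose-S-↭ i≢j p) f (λ {σ} {τ} → f-cong {σ} {τ}))

  sumOver-S-flip : ∀ p n (f : Permutation′ n → Carrier) → (∀ {σ τ} → σ Perm.≈ τ → f σ ≈ f τ) →
    sumOver (S p n) (f ∘ flip) ≈ sumOver (S p n) f
  sumOver-S-flip p n f f-cong = trans (sym (sumOver-map flip (S p n) f))
    (sumOver-↭ₚ (map-flip-S-↭ p n) f (λ {σ} {τ} → f-cong {σ} {τ}))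

  infixl 9 _∙_
  _∙_ : ∀ {n} → Matrix n → Permutation′ n → Fin n → Carrier
  (A ∙ σ) i = A i (σ ⟨$⟩ʳ i)

  ∙-≈ : ∀ {n} (A : Matrix n) {σ τ} → σ Perm.≈ τ → ∀ i → (A ∙ σ) i ≈ (A ∙ τ) i
  ∙-≈ A σ≈τ i = reflexive (cong (A i) (σ≈τ i))

  su-subdiagonal : ∀ {n} (A : Matrix n) σ rows → su A (subdiagonal σ rows) ≈ sumOver rows (A ∙ σ)
  su-subdiagonal A σ rows = sumOver-map (λ i → i , σ ⟨$⟩ʳ i) rows (λ (i , j) → A i j)

  module _ (P : Carrier → Carrier) (P-cong : ∀ {x y} → x ≈ y → P x ≈ P y) where

    full : ∀ {n} → (Fin n → Carrier) → Carrier
    full d = P (sum d)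

    -- Subtracting `d r`, rather than summing over the other indices, makes reindexing immediate;
    -- `without-cong` recovers that the value at `r` does not matter.
    without : ∀ {n} → (Fin n → Carrier) → Fin n → Carrier
    without d r = P (sum d - d r)

    full-cong : ∀ {n} {d e : Fin n → Carrier} → (∀ i → d i ≈ e i) → full d ≈ full e
    full-cong d≈e = P-cong (sum-cong-≋ d≈e)

    without-cong : ∀ {n} {d e : Fin n → Carrier} r → (∀ i → i ≢ r → d i ≈ e i) → without d r ≈ without e r
    without-cong {suc n} {d} {e} r d≈e = P-cong
      (trans (sum-minus d) (trans (sum-cong-≋ (λ i → d≈e _ (Fin.punchInᵢ≢i r i))) (sym (sum-minus e))))
      where
      sum-minus : ∀ d → sum d - d r ≈ sum (d ∘ punchIn r)
      sum-minus d = trans (+-congʳ (sum-remove d)) (x+y-x≈y (d r) _)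

    sum-without-cong : ∀ {n} {d e : Fin n → Carrier} → (∀ i → d i ≈ e i) → sum (without d) ≈ sum (without e)
    sum-without-cong d≈e = sum-cong-≋ (λ r → without-cong r (λ i _ → d≈e i))

    full-permute : ∀ {n} (d : Fin n → Carrier) (π : Permutation′ n) → full (λ i → d (π ⟨$⟩ʳ i)) ≈ full d
    full-permute d π = P-cong (sym (sum-permute d π))

    sum-without-permute : ∀ {n} (d : Fin n → Carrier) (π : Permutation′ n) →
      sum (without (λ i → d (π ⟨$⟩ʳ i))) ≈ sum (without d)
    sum-without-permute {n} d π = trans
      (sum-cong-≋ {n} (λ r → P-cong (+-congʳ (sym (sum-permute d π)))))
      (sym (sum-permute (without d) π))

    sumOver-L-full : ∀ {m} (A : Matrix (suc m)) p →
      sumOver (L p (suc m) (suc m)) (λ l → P (su A l)) ≈ sumOver (S p (suc m)) (λ σ → full (A ∙ σ))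
    sumOver-L-full {m} A p = begin
      sumOver (L p n n) (λ l → P (su A l))
        ≡⟨ cong (λ ls → sumOver ls (λ l → P (su A l))) (L-full p m) ⟩
      sumOver (cartesianProductWith subdiagonal (S p n) [ allFin n ]) (λ l → P (su A l))
        ≈⟨ sumOver-cartesianProductWith subdiagonal (S p n) [ allFin n ] _ ⟩
      sumOver (S p n) (λ σ → P (su A (subdiagonal σ (allFin n))) + 0#)
        ≈⟨ sumOver-cong (S p n) (λ σ → trans (+-identityʳ _)
             (P-cong (trans (su-subdiagonal A σ (allFin n)) (sumOver-tabulate id (A ∙ σ))))) ⟩
      sumOver (S p n) (λ σ → full (A ∙ σ)) ∎
      where n = suc m

    sumOver-L-without : ∀ {m} (A : Matrix (suc m)) p →
      sumOver (L p (suc m) m) (λ l → P (su A l)) ≈ sumOver (S p (suc m)) (λ σ → sum (without (A ∙ σ)))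
    sumOver-L-without {m} A p = begin
      sumOver (L p n m) (λ l → P (su A l))
        ≡⟨ cong (λ ls → sumOver ls (λ l → P (su A l))) (L-omitOne p m) ⟩
      sumOver (cartesianProductWith subdiagonal (S p n) (omitOne (allFin n))) (λ l → P (su A l))
        ≈⟨ sumOver-cartesianProductWith subdiagonal (S p n) (omitOne (allFin n)) _ ⟩
      sumOver (S p n) (λ σ → sumOver (omitOne (allFin n)) (λ rows → P (su A (subdiagonal σ rows))))
        ≈⟨ sumOver-cong (S p n) (λ σ → begin
          sumOver (omitOne (allFin n)) (λ rows → P (su A (subdiagonal σ rows)))
            ≈⟨ sumOver-cong (omitOne (allFin n)) (λ rows → P-cong (su-subdiagonal A σ rows)) ⟩
          sumOver (omitOne (allFin n)) (λ rows → P (sumOver rows (A ∙ σ)))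
            ≈⟨ sumOver-omitOne P P-cong (allFin n) (A ∙ σ) ⟩
          sumOver (allFin n) (λ r → P (sumOver (allFin n) (A ∙ σ) - (A ∙ σ) r))
            ≈⟨ sumOver-tabulate {n = n} id _ ⟩
          sum (λ r → P (sumOver (allFin n) (A ∙ σ) - (A ∙ σ) r))
            ≈⟨ sum-cong-≋ {n} (λ r → P-cong (+-congʳ {x = - (A ∙ σ) r} (sumOver-tabulate id (A ∙ σ)))) ⟩
          sum (without (A ∙ σ)) ∎) ⟩
      sumOver (S p n) (λ σ → sum (without (A ∙ σ))) ∎
      where n = suc m

    -- Groups the four sums of the determinant by parity. Interchanging rows exchanges the two
    -- excesses, transposition preserves each, and a zero row makes them equal.
    excess : ∀ {n} → Matrix n → Parity → Carrier
    excess {n} A p = sumOver (S p n) (λ σ → sum (without (A ∙ σ))) - sumOver (S p n) (λ σ → full (A ∙ σ))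

    excess-cong : ∀ {n} {A B : Matrix n} → (∀ i j → A i j ≈ B i j) → ∀ p → excess A p ≈ excess B p
    excess-cong {n} A≈B p = //-cong₂
      (sumOver-cong (S p n) (λ σ → sum-without-cong (λ i → A≈B i _)))
      (sumOver-cong (S p n) (λ σ → full-cong (λ i → A≈B i _)))

    -- The diagonal of the new matrix along `σ` is the diagonal of `A` along `τ ∘ₚ σ`, read in the
    -- order given by `τ`. The reading order does not affect the sums, and `σ ↦ τ ∘ₚ σ` exchanges
    -- the parities.
    excess-transpose-rows : ∀ {n} (A : Matrix n) {i j} → i ≢ j → ∀ p →
      excess (λ r s → A (transpose i j r) s) p ≈ excess A (p ⁻¹)
    excess-transpose-rows {n} A {i} {j} i≢j p = //-cong₂
      (trans (sumOver-cong (S p n) (λ σ → trans (sum-without-cong (agree σ))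
                                                      (sum-without-permute (A ∙ (τ ∘ₚ σ)) τ)))
             (sumOver-S-transpose i≢j p (λ σ → sum (without (A ∙ σ)))
               (λ {σ} {ρ} σ≈ρ → sum-without-cong (∙-≈ A {σ} {ρ} σ≈ρ))))
      (trans (sumOver-cong (S p n) (λ σ → trans (full-cong (agree σ)) (full-permute (A ∙ (τ ∘ₚ σ)) τ)))
             (sumOver-S-transpose i≢j p (λ σ → full (A ∙ σ)) (λ {σ} {ρ} σ≈ρ → full-cong (∙-≈ A {σ} {ρ} σ≈ρ))))
      where
      τ = Perm.transpose i j
      agree : ∀ σ k → A (transpose i j k) (σ ⟨$⟩ʳ k) ≈ (A ∙ (τ ∘ₚ σ)) (transpose i j k)
      agree σ k = reflexive (cong (λ l → A (transpose i j k) (σ ⟨$⟩ʳ l)) (≡.sym (transpose-involutive i j k)))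

    -- The diagonal of the transposed matrix along `σ` is that of `A` along `flip σ`, read in the
    -- order given by `σ`; `flip` preserves parity.
    excess-ᵀ : ∀ {n} (A : Matrix n) p → excess (λ r s → A s r) p ≈ excess A p
    excess-ᵀ {n} A p = //-cong₂
      (trans (sumOver-cong (S p n) (λ σ → trans (sum-without-cong (agree σ))
                                                      (sum-without-permute (A ∙ flip σ) σ)))
             (sumOver-S-flip p n (λ σ → sum (without (A ∙ σ)))
               (λ {σ} {ρ} σ≈ρ → sum-without-cong (∙-≈ A {σ} {ρ} σ≈ρ))))
      (trans (sumOver-cong (S p n) (λ σ → trans (full-cong (agree σ)) (full-permute (A ∙ flip σ) σ)))
             (sumOver-S-flip p n (λ σ → full (A ∙ σ)) (λ {σ} {ρ} σ≈ρ → full-cong (∙-≈ A {σ} {ρ} σ≈ρ))))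
      where
      agree : ∀ σ k → A (σ ⟨$⟩ʳ k) k ≈ (A ∙ flip σ) (σ ⟨$⟩ʳ k)
      agree σ k = reflexive (cong (A (σ ⟨$⟩ʳ k)) (≡.sym (inverseˡ σ)))

    -- Omitting the zero row i leaves the sum of a diagonal unchanged, whereas for r ≢ i
    -- the diagonals of σ and σ ∘ (r i) have the same sum outside row r.
    excess-zero-row : ∀ {n} (A : Matrix n) i → (∀ s → A i s ≈ 0#) → excess A 0ℙ ≈ excess A 1ℙ
    excess-zero-row {suc m} A i Aᵢ≈0 = trans (remainder 0ℙ)
      (trans (sum-cong-≋ (λ y → cancel (punchIn i y) (Fin.punchInᵢ≢i i y))) (sym (remainder 1ℙ)))
      where
      n = suc m
      Q : Fin n → Parity → Carrier
      Q r p = sumOver (S p n) (λ σ → without (A ∙ σ) r)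
      Q-i : ∀ p → Q i p ≈ sumOver (S p n) (λ σ → full (A ∙ σ))
      Q-i p = sumOver-cong (S p n) (λ σ → P-cong
        (trans (+-congˡ (trans (-‿cong (Aᵢ≈0 (σ ⟨$⟩ʳ i))) ε⁻¹≈ε)) (+-identityʳ _)))
      remainder : ∀ p → excess A p ≈ sum (λ y → Q (punchIn i y) p)
      remainder p = trans
        (+-congʳ (trans (sumOver-sum (S p n) (λ σ → without (A ∙ σ)))
          (trans (sum-remove (λ r → Q r p)) (+-congʳ (Q-i p)))))
        (x+y-x≈y _ _)
      cancel : ∀ r → r ≢ i → Q r 0ℙ ≈ Q r 1ℙ
      cancel r r≢i = trans
        (sumOver-cong (S 0ℙ n) (λ σ → without-cong r (λ k k≢r → agree σ k k≢r (k Fin.≟ i))))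
        (sumOver-S-transpose r≢i 0ℙ (λ σ → without (A ∙ σ) r)
          (λ {σ} {ρ} σ≈ρ → without-cong r (λ k _ → ∙-≈ A {σ} {ρ} σ≈ρ k)))
        where
        agree : ∀ σ k → k ≢ r → Dec (k ≡ i) → A k (σ ⟨$⟩ʳ k) ≈ A k (σ ⟨$⟩ʳ transpose r i k)
        agree σ k k≢r (yes ≡.refl) = trans (Aᵢ≈0 _) (sym (Aᵢ≈0 _))
        agree σ k k≢r (no k≢i)     = reflexive (cong (λ l → A k (σ ⟨$⟩ʳ l)) (≡.sym (transpose-≢ k≢r k≢i)))

  -- Turns the order of the four sums in the definition into the even excess minus the odd one.
  [a-b+c]-d : ∀ a b c d → a - b + c - d ≈ (a - d) - (b - c)
  [a-b+c]-d a b c d = begin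
    (a + - b + c) + - d      ≈⟨ xy∙z≈xz∙y (a + - b) c (- d) ⟩
    (a + - b + - d) + c      ≈⟨ +-congʳ (xy∙z≈xz∙y a (- b) (- d)) ⟩
    (a + - d + - b) + c      ≈⟨ xy∙z≈x∙zy (a + - d) (- b) c ⟩
    (a + - d) + (c + - b)    ≈⟨ +-congˡ (sym (⁻¹-anti-homo‿- b c)) ⟩
    (a - d) - (b - c)        ∎

  ^1+-cong : ∀ m {x y} → x ≈ y → x ^1+ m ≈ y ^1+ m
  ^1+-cong zero    x≈y = x≈y
  ^1+-cong (suc m) x≈y = *-cong x≈y (^1+-cong m x≈y)

  bracketed-cong : ∀ t {x y} → x ≈ y → bracketed x t ≈ bracketed y t
  bracketed-cong (leaf _)     x≈y = x≈y
  bracketed-cong (node s _ t) x≈y = *-cong (bracketed-cong s x≈y) (bracketed-cong t x≈y)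

-- Division by integers respects equality, zero and negation.

module Division {c ℓ} (D : DivisibleRng c ℓ) where
  open DivisibleRng D using (1/_of_; division; Ass)
  open NonAssociativeRng (rng D) hiding (AssociativePowers; sum; _-_)
  open AbelianGroup +-abelianGroup
    using (refl; sym; trans)
    renaming (∙-congˡ to +-congˡ; identityˡ to +-identityˡ; ⁻¹-cong to -‿cong)
  open AbelianGroupProperties +-abelianGroup using (ε⁻¹≈ε; ⁻¹-∙-comm)
  open Alternating (rng D) using (bracketed-cong; sumOver-cong)

  ·ℕ-injective : ∀ m .{{_ : ℕ.NonZero m}} {x y} → m ·ℕ x ≈ m ·ℕ y → x ≈ y
  ·ℕ-injective m = proj₁ (division (ℤ.+ m) (λ eq → ℕ.≢-nonZero⁻¹ m (cong ℤ.∣_∣ eq)))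

  ·ℕ-1/ : ∀ m .{{_ : ℕ.NonZero m}} x → m ·ℕ (1/ m of x) ≈ x
  ·ℕ-1/ m x = proj₂ (proj₂ (division (ℤ.+ m) (λ eq → ℕ.≢-nonZero⁻¹ m (cong ℤ.∣_∣ eq))) x) refl

  ·ℕ-zero : ∀ m → m ·ℕ 0# ≈ 0#
  ·ℕ-zero zero    = refl
  ·ℕ-zero (suc m) = trans (+-identityˡ _) (·ℕ-zero m)

  ·ℕ-neg : ∀ m x → m ·ℕ (- x) ≈ - (m ·ℕ x)
  ·ℕ-neg zero    x = sym ε⁻¹≈ε
  ·ℕ-neg (suc m) x = trans (+-congˡ (·ℕ-neg m x)) (⁻¹-∙-comm x (m ·ℕ x))

  -- `1/_of_` picks a preimage, so congruence is not automatic. As in the two rules that follow,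
  -- both sides are compared after multiplication by `m`, which is injective.
  1/-cong : ∀ m .{{_ : ℕ.NonZero m}} {x y} → x ≈ y → 1/ m of x ≈ 1/ m of y
  1/-cong m {x} {y} x≈y = ·ℕ-injective m (trans (·ℕ-1/ m x) (trans x≈y (sym (·ℕ-1/ m y))))

  1/-zero : ∀ m .{{_ : ℕ.NonZero m}} → 1/ m of 0# ≈ 0#
  1/-zero m = ·ℕ-injective m (trans (·ℕ-1/ m 0#) (sym (·ℕ-zero m)))

  1/-neg : ∀ m .{{_ : ℕ.NonZero m}} x → 1/ m of (- x) ≈ - (1/ m of x)
  1/-neg m x = ·ℕ-injective m (trans (·ℕ-1/ m (- x)) (sym (trans (·ℕ-neg m _) (-‿cong (·ℕ-1/ m x)))))

  Ass-cong : ∀ m {x y} → x ≈ y → Ass m x ≈ Ass m y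
  Ass-cong m x≈y = 1/-cong (catalan m) {{catalan≢0 m}}
    (sumOver-cong (bracketings (suc m)) (λ t → bracketed-cong t x≈y))

-- Antisymmetry, vanishing and transposition for a general power function.

module EdetWith {c ℓ} (D : DivisibleRng c ℓ)
                (pow : ℕ → NonAssociativeRng.Carrier (rng D) → NonAssociativeRng.Carrier (rng D))
                (pow-cong : ∀ m {x y} → NonAssociativeRng._≈_ (rng D) x y →
                            NonAssociativeRng._≈_ (rng D) (pow m x) (pow m y)) where
  open DivisibleRng D using (1/_of_; edetWith)
  open NonAssociativeRng (rng D) hiding (AssociativePowers; sum; _-_)
  open AbelianGroup +-abelianGroup
    using (setoid; sym; trans; reflexive; _-_)
    renaming (∙-cong to +-cong; ∙-congˡ to +-congˡ; identityʳ to +-identityʳ;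
              inverseʳ to -‿inverseʳ; ⁻¹-cong to -‿cong)
  open AbelianGroupProperties +-abelianGroup
    using (⁻¹-anti-homo‿-; ε⁻¹≈ε; //-cong₂; x≈y⇒x∙y⁻¹≈ε)
  open Alternating (rng D)
  open Division D
  open SetoidReasoning setoid

  private
    det : ∀ {m} → Matrix (suc m) → Carrier
    det = edetWith pow

    ex : ∀ {m} → Matrix (suc m) → Parity → Carrier
    ex {m} = excess (pow m) (pow-cong m)

    1/_!of_ : ∀ n → Carrier → Carrier
    1/ n !of x = 1/_of_ (n !) {{n ℕ.!≢0}} x

    1/!-cong : ∀ n {x y} → x ≈ y → 1/ n !of x ≈ 1/ n !of y
    1/!-cong n = 1/-cong (n !) {{n ℕ.!≢0}}

  det-excess : ∀ {m} (A : Matrix (suc m)) → det A ≈ - (1/ suc m !of (ex A 0ℙ - ex A 1ℙ))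
  det-excess {m} A = -‿cong (1/!-cong (suc m) (trans
    (//-cong₂ (+-cong (//-cong₂ (omitting 0ℙ) (omitting 1ℙ)) (whole 1ℙ)) (whole 0ℙ))
    ([a-b+c]-d _ _ _ _)))
    where
    omitting = sumOver-L-without (pow m) (pow-cong m) A
    whole    = sumOver-L-full (pow m) (pow-cong m) A

  det-cong : ∀ {m} {A B : Matrix (suc m)} → (∀ i j → A i j ≈ B i j) → det A ≈ det B
  det-cong {m} {A} {B} A≈B = trans (det-excess A) (trans
    (-‿cong (1/!-cong (suc m) (//-cong₂ (ex-cong 0ℙ) (ex-cong 1ℙ)))) (sym (det-excess B)))
    where ex-cong = excess-cong (pow m) (pow-cong m) A≈B

  antisymmetricInRows : AntisymmetricInRows (rng D) det
  antisymmetricInRows m A i j i≢j = trans (det-excess A′) (-‿cong (begin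
    1/ suc m !of (ex A′ 0ℙ - ex A′ 1ℙ)     ≈⟨ 1/!-cong (suc m) (//-cong₂ (swap 0ℙ) (swap 1ℙ)) ⟩
    1/ suc m !of (ex A 1ℙ - ex A 0ℙ)       ≈⟨ 1/!-cong (suc m) (sym (⁻¹-anti-homo‿- _ _)) ⟩
    1/ suc m !of (- (ex A 0ℙ - ex A 1ℙ))   ≈⟨ 1/-neg (suc m !) {{suc m ℕ.!≢0}} _ ⟩
    - (1/ suc m !of (ex A 0ℙ - ex A 1ℙ))   ≈⟨ det-excess A ⟨
    det A                                  ∎))
    where
    A′ : Matrix (suc m)
    A′ r s = A (transpose i j r) s
    swap = excess-transpose-rows (pow m) (pow-cong m) A i≢j

  transposeInvariant : TransposeInvariant (rng D) det
  transposeInvariant m A = trans (det-excess A) (trans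
    (-‿cong (1/!-cong (suc m) (//-cong₂ (sym (ex-ᵀ 0ℙ)) (sym (ex-ᵀ 1ℙ)))))
    (sym (det-excess (λ r s → A s r))))
    where ex-ᵀ = excess-ᵀ (pow m) (pow-cong m) A

  vanishesOnZeroRow : VanishesOnZeroRow (rng D) det
  vanishesOnZeroRow m A i Aᵢ≈0 = begin
    det A
      ≈⟨ det-excess A ⟩
    - (1/ suc m !of (ex A 0ℙ - ex A 1ℙ))
      ≈⟨ -‿cong (1/!-cong (suc m) (x≈y⇒x∙y⁻¹≈ε (excess-zero-row (pow m) (pow-cong m) A i Aᵢ≈0))) ⟩
    - (1/ suc m !of 0#)
      ≈⟨ -‿cong (1/-zero (suc m !) {{suc m ℕ.!≢0}}) ⟩
    - 0#
      ≈⟨ ε⁻¹≈ε ⟩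
    0# ∎

  vanishesOnEqualRows : VanishesOnEqualRows (rng D) det
  -- Antisymmetry only shows that twice the value is zero; injectivity of multiplication by 2
  -- removes the factor.
  vanishesOnEqualRows m A i j i≢j Aᵢ≈Aⱼ = ·ℕ-injective 2 (begin
    det A + (det A + 0#)  ≈⟨ +-congˡ (+-identityʳ _) ⟩
    det A + det A         ≈⟨ +-congˡ (trans (det-cong (λ r s → swapped r s (r Fin.≟ i) (r Fin.≟ j)))
                                            (antisymmetricInRows m A i j i≢j)) ⟩
    det A - det A         ≈⟨ -‿inverseʳ (det A) ⟩
    0#                    ≈⟨ ·ℕ-zero 2 ⟨
    2 ·ℕ 0#               ∎)
    where
    swapped : ∀ r s → Dec (r ≡ i) → Dec (r ≡ j) → A r s ≈ A (transpose i j r) s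
    swapped r s (yes ≡.refl) _            =
      trans (Aᵢ≈Aⱼ s) (reflexive (cong (λ k → A k s) (≡.sym (transpose-≡ˡ r j))))
    swapped r s (no _)       (yes ≡.refl) =
      trans (sym (Aᵢ≈Aⱼ s)) (reflexive (cong (λ k → A k s) (≡.sym (transpose-≡ʳ i r))))
    swapped r s (no r≢i)     (no r≢j)     =
      reflexive (cong (λ k → A k s) (≡.sym (transpose-≢ r≢i r≢j)))

  antisymmetricInColumns : AntisymmetricInColumns (rng D) det
  antisymmetricInColumns m A i j i≢j = trans (transposeInvariant m _)
    (trans (antisymmetricInRows m (λ r s → A s r) i j i≢j) (-‿cong (sym (transposeInvariant m A))))

  vanishesOnZeroColumn : VanishesOnZeroColumn (rng D) det
  vanishesOnZeroColumn m A j = trans (transposeInvariant m A) ∘ vanishesOnZeroRow m (λ r s → A s r) j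

  vanishesOnEqualColumns : VanishesOnEqualColumns (rng D) det
  vanishesOnEqualColumns m A i j i≢j =
    trans (transposeInvariant m A) ∘ vanishesOnEqualRows m (λ r s → A s r) i j i≢j

  properties :
    (AntisymmetricInRows (rng D) det × AntisymmetricInColumns (rng D) det) ×
    (VanishesOnZeroRow (rng D) det × VanishesOnZeroColumn (rng D) det) ×
    (VanishesOnEqualRows (rng D) det × VanishesOnEqualColumns (rng D) det) ×
    TransposeInvariant (rng D) det
  properties =
    (antisymmetricInRows , antisymmetricInColumns) ,
    (vanishesOnZeroRow , vanishesOnZeroColumn) ,
    (vanishesOnEqualRows , vanishesOnEqualColumns) ,
    transposeInvariant

-- Associative multiplication implies associative powers.

module PowerAssociativity {c ℓ} (R : NonAssociativeRng c ℓ) where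
  open NonAssociativeRng R using (_≈_; _*_; bracketed; _^1+_; *-cong; +-abelianGroup)
  open ≡ using (refl; sym; trans; cong₂)
  private module G = AbelianGroup +-abelianGroup

  module _ (*-assoc : Associative _≈_ _*_) where

    #leaves≡1+#nodes : (t : Bracketing) → #leaves t ≡ suc (#nodes t)
    #leaves≡1+#nodes (leaf _)     = refl
    #leaves≡1+#nodes (node s _ t) = cong₂ ℕ._+_ (#leaves≡1+#nodes s) (#leaves≡1+#nodes t)

    ^1+-* : ∀ a m n → (a ^1+ m) * (a ^1+ n) ≈ a ^1+ (m ℕ.+ suc n)
    ^1+-* a zero    n = G.refl
    ^1+-* a (suc m) n = G.trans (*-assoc _ _ _) (*-cong G.refl (^1+-* a m n))

    -- Exponents in `_^1+_` are shifted by one, so the right one is the number of inner nodes, one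
    -- less than the number of leaves.
    bracketed≈^1+ : ∀ a t → bracketed a t ≈ a ^1+ #nodes t
    bracketed≈^1+ a (leaf _)     = G.refl
    bracketed≈^1+ a (node s _ t) =
      G.trans (*-cong (bracketed≈^1+ a s) (bracketed≈^1+ a t)) (^1+-* a (#nodes s) (#nodes t))

    *-assoc⇒associativePowers : AssociativePowers R
    *-assoc⇒associativePowers a s t |s|≡|t| = G.trans (bracketed≈^1+ a s) (G.trans
      (G.reflexive (cong (a ^1+_) (ℕ.suc-injective
        (trans (sym (#leaves≡1+#nodes s)) (trans |s|≡|t| (#leaves≡1+#nodes t))))))
      (G.sym (bracketed≈^1+ a t)))

-- A noncommutative divisible ring refuting the Laplace and product formulas.

module Triangular where
  open ≡ using (refl; sym; trans; cong₂)

  -- (a , b , d) is the upper triangular matrix [[a , b] , [0 , d]] over ℚ.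
  triangularRng : NonAssociativeRng 0ℓ 0ℓ
  triangularRng = record
    { _*_ = λ (a , b , d) (a′ , b′ , d′) → a ℚ.* a′ , a ℚ.* b′ ℚ.+ b ℚ.* d′ , d ℚ.* d′
    ; +-isAbelianGroup = AbelianGroup.isAbelianGroup ℚ³
    ; *-cong = λ { (refl , refl , refl) (refl , refl , refl) → refl , refl , refl }
    ; distrib =
        (λ (a , b , d) (a′ , b′ , d′) (a″ , b″ , d″) →
          ℚ.*-distribˡ-+ a a′ a″ ,
          solve 6 (λ a b b′ d′ b″ d″ → a :* (b′ :+ b″) :+ b :* (d′ :+ d″) :=
                                       (a :* b′ :+ b :* d′) :+ (a :* b″ :+ b :* d″))
            refl a b b′ d′ b″ d″ ,
          ℚ.*-distribˡ-+ d d′ d″) ,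
        (λ (a , b , d) (a′ , b′ , d′) (a″ , b″ , d″) →
          ℚ.*-distribʳ-+ a a′ a″ ,
          solve 6 (λ b d a′ b′ a″ b″ → (a′ :+ a″) :* b :+ (b′ :+ b″) :* d :=
                                       (a′ :* b :+ b′ :* d) :+ (a″ :* b :+ b″ :* d))
            refl b d a′ b′ a″ b″ ,
          ℚ.*-distribʳ-+ d d′ d″)
    }
    where
    open +-*-Solver
    ℚ³ = abelianGroup ℚ.+-0-abelianGroup (abelianGroup ℚ.+-0-abelianGroup ℚ.+-0-abelianGroup)

  open NonAssociativeRng triangularRng using (Carrier; _≈_; _*_; _·ℕ_; _·ℤ_; +-abelianGroup)

  triangular-*-assoc : Associative _≈_ _*_
  triangular-*-assoc (a , b , d) (a′ , b′ , d′) (a″ , b″ , d″) =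
    ℚ.*-assoc a a′ a″ ,
    solve 7 (λ a b a′ b′ d′ b″ d″ →
        (a :* a′) :* b″ :+ (a :* b′ :+ b :* d′) :* d″ := a :* (a′ :* b″ :+ b′ :* d″) :+ b :* (d′ :* d″))
      refl a b a′ b′ d′ b″ d″ ,
    ℚ.*-assoc d d′ d″
    where open +-*-Solver

  infixr 8 _⊙_
  _⊙_ : ℚ → Carrier → Carrier
  r ⊙ (a , b , d) = r ℚ.* a , r ℚ.* b , r ℚ.* d

  ⊙-assoc : ∀ r s t → r ⊙ s ⊙ t ≈ (r ℚ.* s) ⊙ t
  ⊙-assoc r s (a , b , d) = sym (ℚ.*-assoc r s a) , sym (ℚ.*-assoc r s b) , sym (ℚ.*-assoc r s d)

  ⊙-identity : ∀ {r} t → r ≡ 1ℚ → r ⊙ t ≈ t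
  ⊙-identity (a , b , d) refl = ℚ.*-identityˡ a , ℚ.*-identityˡ b , ℚ.*-identityˡ d

  ⊙-cong : ∀ r {s t} → s ≈ t → r ⊙ s ≈ r ⊙ t
  ⊙-cong r (refl , refl , refl) = refl , refl , refl

  -- The recursion runs parallel to that of `_·ℕ_`, which makes the comparison of multiples with
  -- scalings a direct induction.
  fromℕ : ℕ → ℚ
  fromℕ zero    = 0ℚ
  fromℕ (suc m) = 1ℚ ℚ.+ fromℕ m

  fromℤ : ℤ → ℚ
  fromℤ (ℤ.+ m)    = fromℕ m
  fromℤ ℤ.-[1+ m ] = ℚ.- fromℕ (suc m)

  fromℕ-positive : ∀ m → ℚ.Positive (fromℕ (suc m))
  fromℕ-positive zero    = _
  fromℕ-positive (suc m) = ℚ.pos+pos⇒pos 1ℚ (fromℕ (suc m)) {{fromℕ-positive m}}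

  fromℤ-nonZero : ∀ m → m ≢ ℤ.0ℤ → ℚ.NonZero (fromℤ m)
  fromℤ-nonZero (ℤ.+ zero)    m≢0 = contradiction refl m≢0
  fromℤ-nonZero (ℤ.+ (suc m)) _   = ℚ.pos⇒nonZero (fromℕ (suc m)) {{fromℕ-positive m}}
  fromℤ-nonZero ℤ.-[1+ m ]    _   =
    ℚ.neg⇒nonZero (ℚ.- fromℕ (suc m)) {{ℚ.neg-pos {fromℕ (suc m)} (fromℕ-positive m)}}

  ·ℕ≈fromℕ-⊙ : ∀ m t → m ·ℕ t ≈ fromℕ m ⊙ t
  ·ℕ≈fromℕ-⊙ zero    (a , b , d) = sym (ℚ.*-zeroˡ a) , sym (ℚ.*-zeroˡ b) , sym (ℚ.*-zeroˡ d)
  ·ℕ≈fromℕ-⊙ (suc m) t@(a , b , d) with ·ℕ≈fromℕ-⊙ m t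
  ... | a≡ , b≡ , d≡ = step a a≡ , step b b≡ , step d d≡
    where
    step : ∀ x {y} → y ≡ fromℕ m ℚ.* x → x ℚ.+ y ≡ (1ℚ ℚ.+ fromℕ m) ℚ.* x
    step x eq = trans (cong₂ ℚ._+_ (sym (ℚ.*-identityˡ x)) eq) (sym (ℚ.*-distribʳ-+ x 1ℚ (fromℕ m)))

  ·ℤ≈fromℤ-⊙ : ∀ m t → m ·ℤ t ≈ fromℤ m ⊙ t
  ·ℤ≈fromℤ-⊙ (ℤ.+ m)    t = ·ℕ≈fromℕ-⊙ m t
  ·ℤ≈fromℤ-⊙ ℤ.-[1+ m ] t@(a , b , d) with ·ℕ≈fromℕ-⊙ (suc m) t
  ... | a≡ , b≡ , d≡ = step a a≡ , step b b≡ , step d d≡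
    where
    step : ∀ x {y} → y ≡ fromℕ (suc m) ℚ.* x → ℚ.- y ≡ ℚ.- fromℕ (suc m) ℚ.* x
    step x eq = trans (cong ℚ.-_ eq) (ℚ.neg-distribˡ-* (fromℕ (suc m)) x)

  -- Multiplication by `m` is scaling by the nonzero rational `fromℤ m`, and scaling by its
  -- reciprocal inverts it. This inverse is explicit, so determinants of closed matrices evaluate to
  -- numerals.
  triangular : DivisibleRng 0ℓ 0ℓ
  triangular = record
    { rng = triangularRng
    ; division = λ m m≢0 → let instance _ = fromℤ-nonZero m m≢0 in
        (λ {s} {t} ms≈mt → G.trans (cancel m m≢0 s)
          (G.trans (⊙-cong (ℚ.1/ fromℤ m) ms≈mt) (G.sym (cancel m m≢0 t)))) ,
        (λ t → (ℚ.1/ fromℤ m) ⊙ t , λ {s} s≈ → G.trans (·ℤ≈fromℤ-⊙ m s)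
          (G.trans (⊙-cong (fromℤ m) s≈)
            (G.trans (⊙-assoc (fromℤ m) (ℚ.1/ fromℤ m) t) (⊙-identity t (ℚ.*-inverseʳ (fromℤ m))))))
    }
    where
    module G = AbelianGroup +-abelianGroup
    cancel : ∀ m (m≢0 : m ≢ ℤ.0ℤ) t → t ≈ (ℚ.1/_ (fromℤ m) {{fromℤ-nonZero m m≢0}}) ⊙ (m ·ℤ t)
    cancel m m≢0 t = let instance _ = fromℤ-nonZero m m≢0 in
      G.sym (G.trans (⊙-cong (ℚ.1/ fromℤ m) (·ℤ≈fromℤ-⊙ m t))
      (G.trans (⊙-assoc (ℚ.1/ fromℤ m) (fromℤ m) t) (⊙-identity t (ℚ.*-inverseˡ (fromℤ m)))))

  diagonal : Carrier → Carrier → NonAssociativeRng.Matrix triangularRng 2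
  diagonal x y 0F 0F = x
  diagonal x y 1F 1F = y
  diagonal x y _  _  = 0ℚ , 0ℚ , 0ℚ

  1ᵀ E₁₁ E₁₂ : Carrier
  1ᵀ = 1ℚ , 0ℚ , 1ℚ
  E₁₁ = 1ℚ , 0ℚ , 0ℚ
  E₁₂ = 0ℚ , 1ℚ , 0ℚ


  -- The determinant of `diagonal E₁₁ E₁₂` is half of `E₁₂`, because `E₁₂ * E₁₁` is zero. The
  -- expansion gives `E₁₁ * E₁₂`, which is `E₁₂`, since a 1 × 1 determinant is its entry. The middle
  -- coordinates are 1/2 and 1.
  ¬laplaceAlongRows : ¬ LaplaceAlongRows triangularRng (edet triangular)
  ¬laplaceAlongRows laplace with () ← proj₁ (proj₂ (laplace 0 (diagonal E₁₁ E₁₂) 0F))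

  ¬laplaceAlongColumns : ¬ LaplaceAlongColumns triangularRng (edet triangular)
  ¬laplaceAlongColumns laplace with () ← proj₁ (proj₂ (laplace 0 (diagonal E₁₁ E₁₂) 0F))

  -- The product matrix is `diagonal E₁₂ E₁₁`, with determinant half of `E₁₂`; the factors have
  -- determinants `E₁₁` and `E₁₂`, whose product in this order is `E₁₂`. Size 2 is index 1 here, but
  -- index 0 in the Laplace formulas.
  ¬multiplicative : ¬ Multiplicative triangularRng (edet triangular)
  ¬multiplicative mult with () ← proj₁ (proj₂ (mult 1 (diagonal 1ᵀ E₁₁) (diagonal E₁₂ 1ᵀ)))

  -- Products of one or two factors have a single arrangement of brackets, so for these sizes `Ass`
  -- is the ordinary power and the same matrices serve.
  ¬laplaceAlongRows-Ass : ¬ LaplaceAlongRows triangularRng (edetAss triangular)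
  ¬laplaceAlongRows-Ass laplace with () ← proj₁ (proj₂ (laplace 0 (diagonal E₁₁ E₁₂) 0F))

  ¬laplaceAlongColumns-Ass : ¬ LaplaceAlongColumns triangularRng (edetAss triangular)
  ¬laplaceAlongColumns-Ass laplace with () ← proj₁ (proj₂ (laplace 0 (diagonal E₁₁ E₁₂) 0F))

  ¬multiplicative-Ass : ¬ Multiplicative triangularRng (edetAss triangular)
  ¬multiplicative-Ass mult with () ← proj₁ (proj₂ (mult 1 (diagonal 1ᵀ E₁₁) (diagonal E₁₂ 1ᵀ)))

lemma4 : ∀ c ℓ →
  ((R : DivisibleRng c ℓ) → AssociativePowers (rng R) →
    (AntisymmetricInRows (rng R) (edet R) × AntisymmetricInColumns (rng R) (edet R)) ×
    (VanishesOnZeroRow (rng R) (edet R) × VanishesOnZeroColumn (rng R) (edet R)) ×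
    (VanishesOnEqualRows (rng R) (edet R) × VanishesOnEqualColumns (rng R) (edet R)) ×
    TransposeInvariant (rng R) (edet R)) ×
  ((R : DivisibleRng c ℓ) →
    (AntisymmetricInRows (rng R) (edetAss R) × AntisymmetricInColumns (rng R) (edetAss R)) ×
    (VanishesOnZeroRow (rng R) (edetAss R) × VanishesOnZeroColumn (rng R) (edetAss R)) ×
    (VanishesOnEqualRows (rng R) (edetAss R) × VanishesOnEqualColumns (rng R) (edetAss R)) ×
    TransposeInvariant (rng R) (edetAss R)) ×
  (¬ ((R : DivisibleRng 0ℓ 0ℓ) → AssociativePowers (rng R) → LaplaceAlongRows (rng R) (edet R)) ×
   ¬ ((R : DivisibleRng 0ℓ 0ℓ) → AssociativePowers (rng R) → LaplaceAlongColumns (rng R) (edet R)) ×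
   ¬ ((R : DivisibleRng 0ℓ 0ℓ) → AssociativePowers (rng R) → Multiplicative (rng R) (edet R)) ×
   ¬ ((R : DivisibleRng 0ℓ 0ℓ) → AssociativePowers (rng R) →
        (LaplaceAlongRows (rng R) (edet R) × LaplaceAlongColumns (rng R) (edet R)) ×
        (PolyadditiveInRows (rng R) (edet R) × PolyadditiveInColumns (rng R) (edet R)) ×
        Multiplicative (rng R) (edet R))) ×
  (¬ ((R : DivisibleRng 0ℓ 0ℓ) → LaplaceAlongRows (rng R) (edetAss R)) ×
   ¬ ((R : DivisibleRng 0ℓ 0ℓ) → LaplaceAlongColumns (rng R) (edetAss R)) ×
   ¬ ((R : DivisibleRng 0ℓ 0ℓ) → Multiplicative (rng R) (edetAss R)) ×
   ¬ ((R : DivisibleRng 0ℓ 0ℓ) →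
        (LaplaceAlongRows (rng R) (edetAss R) × LaplaceAlongColumns (rng R) (edetAss R)) ×
        (PolyadditiveInRows (rng R) (edetAss R) × PolyadditiveInColumns (rng R) (edetAss R)) ×
        Multiplicative (rng R) (edetAss R)))
lemma4 c ℓ =
  (λ D _ → EdetWith.properties D (λ m a → NonAssociativeRng._^1+_ (rng D) a m)
                                 (Alternating.^1+-cong (rng D))) ,
  (λ D → EdetWith.properties D (DivisibleRng.Ass D) (Division.Ass-cong D)) ,
  ((λ laplace → ¬laplaceAlongRows (laplace triangular assocPowers)) ,
   (λ laplace → ¬laplaceAlongColumns (laplace triangular assocPowers)) ,
   (λ mult → ¬multiplicative (mult triangular assocPowers)) ,
   -- The conjunction is refuted through its multiplicativity component.
   (λ all → ¬multiplicative (proj₂ (proj₂ (all triangular assocPowers))))) ,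
  ((λ laplace → ¬laplaceAlongRows-Ass (laplace triangular)) ,
   (λ laplace → ¬laplaceAlongColumns-Ass (laplace triangular)) ,
   (λ mult → ¬multiplicative-Ass (mult triangular)) ,
   (λ all → ¬multiplicative-Ass (proj₂ (proj₂ (all triangular)))))
  where
  open Triangular
  assocPowers : AssociativePowers (rng triangular)
  assocPowers = PowerAssociativity.*-assoc⇒associativePowers triangularRng triangular-*-assoc
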